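{- There exists an algorithm which, given as input a critical two-dimensional bootstrap percolation update family $\mathcal{U}$, computes its difficulty $\alpha$.
   Context: An update family is a finite set $\mathcal{U}$ of finite subsets (called rules) of $\mathbb{Z}^2\setminus\{0\}$. For $A\subseteq\mathbb{Z}^2$ set $A_0=A$, $A_{t+1}=A_t\cup\{x\in\mathbb{Z}^2:\exists U\in\mathcal{U},\ x+U\subseteq A_t\}$, and let the closure be $[A]=\bigcup_{t\ge0}A_t$. Identify the unit circle $S^1$ with $\mathbb{R}/2\pi\mathbb{Z}$, a direction $u$ corresponding to the unit vector $(\cos u,\sin u)$. Let $\mathbb{H}_u=\{x\in\mathbb{Z}^2:\langle x,u\rangle<0\}$ and $l_u=\{x\in\mathbb{Z}^2:\langle x,u\rangle=0\}$. A direction $u$ is unstable if some $U\in\mathcal{U}$ satisfies $U\subseteq\mathbb{H}_u$, and stable otherwise; the stable set is a finite union of closed intervals of $S^1$, and a stable direction forming a one-point interval is called isolated. $\mathcal{U}$ is supercritical if some open semicircle of $S^1$ consists of unstable directions; critical if it is not supercritical and some open semicircle contains only finitely many stable directions. For a critical $\mathcal{U}$ and a direction $u$: if $u$ is an isolated stable direction, $\alpha(u)$ is the minimum cardinality of a set $Z\subseteq\mathbb{Z}^2\setminus\mathbb{H}_u$ such that $\bar Z:=[\mathbb{H}_u\cup Z]\setminus\mathbb{H}_u$ is infinite; $\alpha(u)=0$ if $u$ is unstable; $\alpha(u)=\infty$ if $u$ is a non-isolated stable direction. The difficulty of $\mathcal{U}$ is $\alpha=\inf_{C}\sup_{u\in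 C}\alpha(u)$, the infimum over all open semicircles $C$ of $S^1$. The family $\mathcal{U}$ is given as input as a list of rules, each a list of integer coordinate pairs written in binary.
   Formalization: Directions u and the centres of open semicircles range over rational directions (nonzero integer vectors) instead of all of the unit circle; since stable intervals have rational endpoints, criticality and the difficulty are unchanged. -}

module Defs where

open import Data.Nat using (ℕ; zero; suc) renaming (_≤_ to _≤ℕ_; _<_ to _<ℕ_)
open import Data.Integer using (ℤ; +_; _+_; _-_; _*_; _<_; _≤_)
open import Data.Product using (Σ; _×_; _,_; ∃; ∃-syntax)
open import Data.Sum using (_⊎_)
open import Data.Maybe using (Maybe; just; nothing)
open import Data.List using (List; length)
open import Data.List.Relation.Unary.All using (All)
open import Data.List.Relation.Unary.Any using (Any)
open import Data.List.Membership.Propositional using (_∈_)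
open import Relation.Binary.PropositionalEquality using (_≡_; _≢_)
open import Relation.Nullary using (¬_)

Point : Set
Point = ℤ × ℤ

origin : Point
origin = (+ 0 , + 0)

_⊕_ : Point → Point → Point
(a , b) ⊕ (c , d) = (a + c , b + d)

⟪_,_⟫ : Point → Point → ℤ
⟪ (a , b) , (c , d) ⟫ = a * c + b * d

cross : Point → Point → ℤ
cross (a , b) (c , d) = a * d - b * c

Rule : Set
Rule = List Point

UpdateFamily : Set
UpdateFamily = List Rule

ValidFamily : UpdateFamily → Set
ValidFamily 𝒰 = All (All (λ x → x ≢ origin)) 𝒰

Step : UpdateFamily → (Point → Set) → (Point → Set)
Step 𝒰 A x = A x ⊎ Any (λ U → All (λ y → A (x ⊕ y)) U) 𝒰

Iter : UpdateFamily → (Point → Set) → ℕ → (Point → Set)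
Iter 𝒰 A zero    = A
Iter 𝒰 A (suc t) = Step 𝒰 (Iter 𝒰 A t)

Closure : UpdateFamily → (Point → Set) → (Point → Set)
Closure 𝒰 A x = ∃[ t ] Iter 𝒰 A t x

FiniteSet : (Point → Set) → Set
FiniteSet P = ∃[ L ] (∀ x → P x → x ∈ L)

InfiniteSet : (Point → Set) → Set
InfiniteSet P = ¬ FiniteSet P

-- Directions.  A direction is represented by a nonzero integer vector
-- (the ray it spans).

Direction : Set
Direction = Σ Point (λ u → u ≢ origin)

vec : Direction → Point
vec (u , _) = u

InH : Direction → Point → Set
InH u x = ⟪ x , vec u ⟫ < + 0

SameDir : Direction → Direction → Set
SameDir u w = (cross (vec u) (vec w) ≡ + 0) × (+ 0 < ⟪ vec u , vec w ⟫)

Unstable : UpdateFamily → Direction → Set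
Unstable 𝒰 u = Any (λ U → All (InH u) U) 𝒰

Stable : UpdateFamily → Direction → Set
Stable 𝒰 u = ¬ Unstable 𝒰 u

-- u is a stable direction with a neighbourhood (the set of directions
-- strictly counterclockwise from v₁ and strictly clockwise from v₂,
-- which is open and contains u) in which every other direction is unstable
IsolatedStable : UpdateFamily → Direction → Set
IsolatedStable 𝒰 u =
  Stable 𝒰 u ×
  ∃[ v₁ ] ∃[ v₂ ]
    ((+ 0 < cross (vec v₁) (vec u)) × (+ 0 < cross (vec u) (vec v₂)) ×
     (∀ w → + 0 < cross (vec v₁) (vec w) → + 0 < cross (vec w) (vec v₂) →
            ¬ SameDir w u → Unstable 𝒰 w))

InSemicircle : Direction → Direction → Set
InSemicircle v u = + 0 < ⟪ vec u , vec v ⟫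

Supercritical : UpdateFamily → Set
Supercritical 𝒰 = ∃[ v ] (∀ u → InSemicircle v u → Unstable 𝒰 u)

Critical : UpdateFamily → Set
Critical 𝒰 =
  ¬ Supercritical 𝒰 ×
  ∃[ v ] ∃[ L ] (∀ u → InSemicircle v u → Stable 𝒰 u →
                   Any (λ w → SameDir u w) L)

-- α(u), valued in ℕ ∪ {∞}; we define the predicate  α(u) ≤ k  for finite k.

ZBar : UpdateFamily → Direction → List Point → (Point → Set)
ZBar 𝒰 u Z x = Closure 𝒰 (λ y → InH u y ⊎ y ∈ Z) x × ¬ InH u x

-- α(u) ≤ k :  u unstable (α = 0), or u isolated stable and some
-- Z ⊆ Z^2 \ H_u with |Z| ≤ k has Z̄ infinite.  (Non-isolated stable: α = ∞.)
AlphaLE : UpdateFamily → Direction → ℕ → Set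
AlphaLE 𝒰 u k =
  Unstable 𝒰 u ⊎
  (IsolatedStable 𝒰 u ×
   ∃[ Z ] ((length Z ≤ℕ k) × All (λ z → ¬ InH u z) Z × InfiniteSet (ZBar 𝒰 u Z)))

DifficultyLE : UpdateFamily → ℕ → Set
DifficultyLE 𝒰 k = ∃[ v ] (∀ u → InSemicircle v u → AlphaLE 𝒰 u k)

IsDifficulty : UpdateFamily → Maybe ℕ → Set
IsDifficulty 𝒰 (just k) = DifficultyLE 𝒰 k × (∀ j → j <ℕ k → ¬ DifficultyLE 𝒰 j)
IsDifficulty 𝒰 nothing  = ∀ k → ¬ DifficultyLE 𝒰 k

{-# OPTIONS --safe #-}
module Submission where

-- Fix a stable direction u.  A finite set Z has finite closure on top of ℍ_u exactly when it lies in a finite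
-- set X such that ℍ_u ∪ X is closed under the rules.  Inside a horizontal strip (with respect to u) the
-- existence of X is a condition on the word of columns of Z that a finite automaton checks, reading windows of X;
-- hence whether some Z with at most k points in the strip has infinite closure is a reachability question in the
-- powerset automaton, with the number of points used so far as a counter.
-- Criticality bounds the height of the strip: the stable directions meet every open semicircle, so k points lie
-- in a finite closed union of droplets (polygons with stable sides) of size bounded in terms of k, and the part
-- of Z above a large gap in the heights cannot influence the rest.
-- Finally, it suffices to consider the directions orthogonal to rule elements (and the four axis directions), and
-- the semicircles ending in them, because the stability of a rotating direction changes only there; and the
-- search for k is bounded because a long segment on the boundary of ℍ_u grows forever when u is isolated.

open import Defs
open import Data.Empty using (⊥; ⊥-elim)
open import Data.Integer as ℤ using (ℤ; +_; -[1+_]; _+_; _-_; _*_; -_; _<_; _≤_; ∣_∣; +≤+; +<+; -≤+; -<+)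
import Data.Integer.Properties as ℤₚ
open import Data.Integer.Tactic.RingSolver using (solve-∀)
open import Data.List using (List; []; _∷_; _++_; length; map; filter; replicate; foldl; concat; concatMap; upTo; cartesianProduct; cartesianProductWith)
import Data.List.Membership.DecPropositional as DecMem
open import Data.List.Membership.Propositional using (_∈_; _∉_; find; lose)
open import Data.List.Membership.Propositional.Properties
import Data.List.Properties as Listₚ
open import Data.List.Relation.Unary.All as All using (All; []; _∷_)
import Data.List.Relation.Unary.All.Properties as Allₚ
open import Data.List.Relation.Unary.AllPairs using (AllPairs; []; _∷_)
open import Data.List.Relation.Unary.Any as Any using (Any; here; there; any?)
open import Data.Maybe using (Maybe; just; nothing)
open import Data.Nat as ℕ using (ℕ; zero; suc)
open import Data.Nat.ListAction using (sum)
open import Data.Nat.ListAction.Properties using (sum-++)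
import Data.Nat.Properties as ℕₚ
open import Data.Product using (Σ; _×_; _,_; ∃; ∃-syntax; proj₁; proj₂)
open import Data.Product.Properties using (≡-dec)
open import Data.Sum as Sum using (_⊎_; inj₁; inj₂)
open import Function using (_∘_)
open import Relation.Binary using (DecidableEquality; Tri; tri<; tri≈; tri>)
open import Relation.Binary.PropositionalEquality
open import Relation.Nullary using (¬_; Dec; yes; no)
open import Relation.Nullary.Decidable using (_×-dec_; _⊎-dec_; _→-dec_; ¬?; decidable-stable; map′)
open import Relation.Unary using (Decidable)

-- Integers

-- The closure is only enumerated from inside, so its finiteness cannot be observed along the way. A
-- finite closed `X` turns finiteness into an existential statement with a local condition: each
-- firing of a rule is checked inside one window. An automaton guesses the windows of `X`, and
-- infinite closure means that every guess fails; this is why determinisation is needed. The points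
-- of `Z` may be spread far apart, so words are unbounded in length, and only their weight is
-- bounded. All constants are crude: the height of the strip only has to be computable from `k` and
-- the rules. What matters about droplets is that distant ones have a union which is closed without
-- any help from the half-plane. `InfiniteSet` is a negation, so a rejected word is recovered from
-- it through the decidability of `Accept` and `Rejected`. Isolation quantifies over neighbourhoods
-- and is replaced by the finite test `TwoSided`.

diff≥0 : ∀ {a b} → a ≤ b → + 0 ≤ b - a
diff≥0 = ℤₚ.i≤j⇒0≤j-i

≤-by : ∀ {e c d} → + 0 ≤ e → d - c ≡ e → c ≤ d
≤-by h eq = ℤₚ.0≤i-j⇒j≤i (subst (+ 0 ≤_) (sym eq) h)

diff>0 : ∀ {a b} → a < b → + 0 < b - a
diff>0 {a} {b} h = subst (_< b - a) (ℤₚ.+-inverseʳ a) (ℤₚ.+-monoˡ-< (- a) h)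

<-by : ∀ {e c d} → + 0 < e → d - c ≡ e → c < d
<-by {e} {c} {d} h eq = subst₂ _<_ (ℤₚ.+-identityˡ c) (lem d c) (ℤₚ.+-monoˡ-< c (subst (+ 0 <_) (sym eq) h))
  where
  lem : ∀ d c → d - c + c ≡ d
  lem = solve-∀

≥0+≥0 : ∀ {a b} → + 0 ≤ a → + 0 ≤ b → + 0 ≤ a + b
≥0+≥0 = ℤₚ.+-mono-≤

>0+≥0 : ∀ {a b} → + 0 < a → + 0 ≤ b → + 0 < a + b
>0+≥0 = ℤₚ.+-mono-<-≤

≥0+>0 : ∀ {a b} → + 0 ≤ a → + 0 < b → + 0 < a + b
≥0+>0 = ℤₚ.+-mono-≤-<

>0+>0 : ∀ {a b} → + 0 < a → + 0 < b → + 0 < a + b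
>0+>0 = ℤₚ.+-mono-<

≥0*≥0 : ∀ {a b} → + 0 ≤ a → + 0 ≤ b → + 0 ≤ a * b
≥0*≥0 {a} {b} p q = subst (_≤ a * b) (ℤₚ.*-zeroʳ a) (ℤₚ.*-monoˡ-≤-nonNeg a {{ℤ.nonNegative p}} q)

>0*>0 : ∀ {a b} → + 0 < a → + 0 < b → + 0 < a * b
>0*>0 {a} {b} p q = subst (_< a * b) (ℤₚ.*-zeroʳ a) (ℤₚ.*-monoˡ-<-pos a {{ℤ.positive p}} q)

pos*neg : ∀ {a b} → + 0 < a → b < + 0 → a * b < + 0
pos*neg {a} {b} p q = subst (a * b <_) (ℤₚ.*-zeroʳ a) (ℤₚ.*-monoˡ-<-pos a {{ℤ.positive p}} q)

square≥0 : ∀ a → + 0 ≤ a * a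
square≥0 (+ n) = ≥0*≥0 {+ n} {+ n} (+≤+ ℕ.z≤n) (+≤+ ℕ.z≤n)
square≥0 -[1+ n ] = +≤+ ℕ.z≤n

square>0 : ∀ a → a ≢ + 0 → + 0 < a * a
square>0 a a≢0 = ℤₚ.≤∧≢⇒< (square≥0 a) λ e → noz (ℤₚ.i*j≡0⇒i≡0∨j≡0 a (sym e))
  where
  noz : a ≡ + 0 ⊎ a ≡ + 0 → ⊥
  noz (inj₁ e) = a≢0 e
  noz (inj₂ e) = a≢0 e

>0⇒-<0 : ∀ {a} → + 0 < a → - a < + 0
>0⇒-<0 {a} h = ℤₚ.neg-mono-< h

<0⇒->0 : ∀ {a} → a < + 0 → + 0 < - a
<0⇒->0 {a} h = ℤₚ.neg-mono-< h

≤0⇒-≥0 : ∀ {a} → a ≤ + 0 → + 0 ≤ - a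
≤0⇒-≥0 h = ℤₚ.neg-mono-≤ h

cancel->0 : ∀ {k a} → + 0 < k → + 0 < k * a → + 0 < a
cancel->0 {k} {a} p q = ℤₚ.*-cancelˡ-<-nonNeg k {{ℤ.nonNegative (ℤₚ.<⇒≤ p)}} (subst (_< k * a) (sym (ℤₚ.*-zeroʳ k)) q)

cancel-<0 : ∀ {k a} → + 0 < k → k * a < + 0 → a < + 0
cancel-<0 {k} {a} p q = ℤₚ.*-cancelˡ-<-nonNeg k {{ℤ.nonNegative (ℤₚ.<⇒≤ p)}} (subst (k * a <_) (sym (ℤₚ.*-zeroʳ k)) q)

cancel-≡0 : ∀ {k a} → + 0 < k → k * a ≡ + 0 → a ≡ + 0
cancel-≡0 {k} {a} p q with ℤₚ.i*j≡0⇒i≡0∨j≡0 k q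
... | inj₁ refl = ⊥-elim (ℤₚ.<-irrefl refl p)
... | inj₂ e = e

abs-bounds : ∀ a {n} → ∣ a ∣ ℕ.≤ n → (- (+ n) ≤ a) × (a ≤ + n)
abs-bounds (+ m) h = ℤₚ.≤-trans (ℤₚ.neg-mono-≤ {+ 0} (+≤+ ℕ.z≤n)) (+≤+ ℕ.z≤n) , +≤+ h
abs-bounds -[1+ m ] {suc n} (ℕ.s≤s h) = ℤ.-≤- h , -≤+

bounds-abs : ∀ a {n} → - (+ n) ≤ a → a ≤ + n → ∣ a ∣ ℕ.≤ n
bounds-abs (+ m) p (+≤+ q) = q
bounds-abs -[1+ m ] {suc n} (ℤ.-≤- p) q = ℕ.s≤s p

-- Plane vectors

perp : Point → Point
perp (a , b) = (- b , a)

neg : Point → Point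
neg (a , b) = (- a , - b)

infixr 7 _⊗_
_⊗_ : ℤ → Point → Point
k ⊗ (a , b) = (k * a , k * b)

⟪⟫-⊕ˡ : ∀ x y u → ⟪ x ⊕ y , u ⟫ ≡ ⟪ x , u ⟫ + ⟪ y , u ⟫
⟪⟫-⊕ˡ (a , b) (c , d) (e , f) = lem a b c d e f where
  lem : ∀ a b c d e f → (a + c) * e + (b + d) * f ≡ (a * e + b * f) + (c * e + d * f)
  lem = solve-∀

⟪⟫-comm : ∀ x u → ⟪ x , u ⟫ ≡ ⟪ u , x ⟫
⟪⟫-comm (a , b) (e , f) = lem a b e f where
  lem : ∀ a b e f → a * e + b * f ≡ e * a + f * b
  lem = solve-∀

⟪⟫-⊗ˡ : ∀ k y u → ⟪ k ⊗ y , u ⟫ ≡ k * ⟪ y , u ⟫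
⟪⟫-⊗ˡ k (c , d) (e , f) = lem k c d e f where
  lem : ∀ k c d e f → k * c * e + k * d * f ≡ k * (c * e + d * f)
  lem = solve-∀

⟪⟫-negˡ : ∀ y u → ⟪ neg y , u ⟫ ≡ - ⟪ y , u ⟫
⟪⟫-negˡ (c , d) (e , f) = lem c d e f where
  lem : ∀ c d e f → - c * e + - d * f ≡ - (c * e + d * f)
  lem = solve-∀

⟪⟫-⊕ʳ : ∀ x u v → ⟪ x , u ⊕ v ⟫ ≡ ⟪ x , u ⟫ + ⟪ x , v ⟫
⟪⟫-⊕ʳ x u v = trans (⟪⟫-comm x (u ⊕ v)) (trans (⟪⟫-⊕ˡ u v x) (cong₂ _+_ (⟪⟫-comm u x) (⟪⟫-comm v x)))

⟪⟫-⊗ʳ : ∀ k x u → ⟪ x , k ⊗ u ⟫ ≡ k * ⟪ x , u ⟫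
⟪⟫-⊗ʳ k x u = trans (⟪⟫-comm x (k ⊗ u)) (trans (⟪⟫-⊗ˡ k u x) (cong (k *_) (⟪⟫-comm u x)))

⟪⟫-negʳ : ∀ x u → ⟪ x , neg u ⟫ ≡ - ⟪ x , u ⟫
⟪⟫-negʳ x u = trans (⟪⟫-comm x (neg u)) (trans (⟪⟫-negˡ u x) (cong -_ (⟪⟫-comm u x)))

perp-orth : ∀ u → ⟪ perp u , u ⟫ ≡ + 0
perp-orth (a , b) = lem a b where
  lem : ∀ a b → - b * a + a * b ≡ + 0
  lem = solve-∀

perp-norm : ∀ u → ⟪ perp u , perp u ⟫ ≡ ⟪ u , u ⟫
perp-norm (a , b) = lem a b where
  lem : ∀ a b → - b * - b + a * a ≡ a * a + b * b
  lem = solve-∀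

cross-⟪⟫ : ∀ u x → cross u x ≡ ⟪ x , perp u ⟫
cross-⟪⟫ (a , b) (c , d) = lem a b c d where
  lem : ∀ a b c d → a * d - b * c ≡ c * - b + d * a
  lem = solve-∀

cross-⟪⟫′ : ∀ x u → cross x u ≡ - ⟪ x , perp u ⟫
cross-⟪⟫′ (a , b) (c , d) = lem a b c d where
  lem : ∀ a b c d → a * d - b * c ≡ - (a * - d + b * c)
  lem = solve-∀

norm>0 : ∀ u → u ≢ origin → + 0 < ⟪ u , u ⟫
norm>0 (a , b) u≢0 with a ℤₚ.≟ + 0 | b ℤₚ.≟ + 0
... | yes refl | yes refl = ⊥-elim (u≢0 refl)
... | no a≢0 | _ = >0+≥0 (square>0 a a≢0) (square≥0 b)
... | yes _ | no b≢0 = ≥0+>0 (square≥0 a) (square>0 b b≢0)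

decompose : ∀ u x w → ⟪ u , u ⟫ * ⟪ x , w ⟫ ≡ ⟪ w , u ⟫ * ⟪ x , u ⟫ + ⟪ w , perp u ⟫ * ⟪ x , perp u ⟫
decompose (a , b) (c , d) (e , f) = lem a b c d e f where
  lem : ∀ a b c d e f → (a * a + b * b) * (c * e + d * f) ≡ (e * a + f * b) * (c * a + d * b) + (e * - b + f * a) * (c * - b + d * a)
  lem = solve-∀

⟪origin⟫ : ∀ u → ⟪ origin , u ⟫ ≡ + 0
⟪origin⟫ (a , b) = lem a b where
  lem : ∀ a b → + 0 * a + + 0 * b ≡ + 0
  lem = solve-∀

nonzero-by : ∀ {u τ} → + 0 < ⟪ u , τ ⟫ → u ≢ origin
nonzero-by {u} {τ} h refl = ℤₚ.<-irrefl (sym (⟪origin⟫ τ)) h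

perp≢0 : ∀ {u} → u ≢ origin → perp u ≢ origin
perp≢0 {u} h e = nonzero-by {perp u} {perp u} (subst (+ 0 <_) (sym (perp-norm u)) (norm>0 u h)) e

neg≢0 : ∀ {u} → u ≢ origin → neg u ≢ origin
neg≢0 {u} h e = nonzero-by {neg u} {neg u} (subst (+ 0 <_) (sym (trans (⟪⟫-negˡ u (neg u)) (trans (cong -_ (⟪⟫-negʳ u u)) (ℤₚ.neg-involutive _)))) (norm>0 u h)) e

-- c′ is c rotated towards w until it is orthogonal to x.
turn : ∀ x w c τ → + 0 ≤ ⟪ x , w ⟫ → ⟪ x , c ⟫ < + 0 → + 0 < ⟪ w , τ ⟫ → + 0 < ⟪ c , τ ⟫ →
       ∃[ c′ ] ((c′ ≡ perp x ⊎ c′ ≡ neg (perp x)) × + 0 < ⟪ c′ , τ ⟫ × ⟪ x , c′ ⟫ ≡ + 0 ×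
                (∀ y → + 0 ≤ ⟪ y , w ⟫ → ⟪ y , c′ ⟫ < + 0 → ⟪ y , c ⟫ < + 0))
turn x w c τ xw xc wτ cτ = go (ℤₚ.<-cmp (+ 0) ⟪ z , perp x ⟫)
  where
  α β N : ℤ
  α = - ⟪ x , c ⟫
  β = ⟪ x , w ⟫
  N = ⟪ x , x ⟫
  α>0 : + 0 < α
  α>0 = <0⇒->0 xc
  -- The combination of `w` and `c` with nonnegative coefficients that is orthogonal to `x`. It
  -- points along `perp x` or its negative, and any `y` that is nonnegative on `w` and `c` is
  -- nonnegative on it.
  z : Point
  z = (α ⊗ w) ⊕ (β ⊗ c)
  ⟪y,z⟫ : ∀ y → ⟪ y , z ⟫ ≡ α * ⟪ y , w ⟫ + β * ⟪ y , c ⟫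
  ⟪y,z⟫ y = trans (⟪⟫-⊕ʳ y (α ⊗ w) (β ⊗ c)) (cong₂ _+_ (⟪⟫-⊗ʳ α y w) (⟪⟫-⊗ʳ β y c))
  τz>0 : + 0 < ⟪ τ , z ⟫
  τz>0 = subst (+ 0 <_) (sym (⟪y,z⟫ τ))
    (>0+≥0 (>0*>0 α>0 (subst (+ 0 <_) (⟪⟫-comm w τ) wτ)) (≥0*≥0 xw (ℤₚ.<⇒≤ (subst (+ 0 <_) (⟪⟫-comm c τ) cτ))))
  xz≡0 : ⟪ z , x ⟫ ≡ + 0
  xz≡0 = trans (⟪⟫-comm z x) (trans (⟪y,z⟫ x) (lem ⟪ x , c ⟫ ⟪ x , w ⟫))
    where
    lem : ∀ a b → - a * b + b * a ≡ + 0
    lem = solve-∀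
  N>0 : + 0 < N
  N>0 = norm>0 x λ { refl → ℤₚ.<-irrefl (⟪origin⟫ c) xc }
  yz : ∀ y → N * ⟪ y , z ⟫ ≡ ⟪ z , perp x ⟫ * ⟪ y , perp x ⟫
  yz y = trans (decompose x y z) (trans (cong (λ a → a * ⟪ y , x ⟫ + ⟪ z , perp x ⟫ * ⟪ y , perp x ⟫) xz≡0) (ℤₚ.+-identityˡ _))
  close : ∀ c′ k → + 0 < k → (∀ y → N * ⟪ y , z ⟫ ≡ k * ⟪ y , c′ ⟫) →
          + 0 < ⟪ c′ , τ ⟫ × ⟪ x , c′ ⟫ ≡ + 0 × (∀ y → + 0 ≤ ⟪ y , w ⟫ → ⟪ y , c′ ⟫ < + 0 → ⟪ y , c ⟫ < + 0)
  close c′ k k>0 eq =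
      subst (+ 0 <_) (⟪⟫-comm τ c′) (cancel->0 k>0 (subst (+ 0 <_) (eq τ) (>0*>0 N>0 τz>0)))
    , cancel-≡0 k>0 (trans (sym (eq x)) (trans (cong (N *_) (trans (⟪⟫-comm x z) xz≡0)) (ℤₚ.*-zeroʳ N)))
    , λ y yw yc′ → ℤₚ.≰⇒> λ yc≥0 → ℤₚ.<-irrefl refl (ℤₚ.<-≤-trans (pos*neg k>0 yc′)
        (subst (+ 0 ≤_) (eq y) (≥0*≥0 (ℤₚ.<⇒≤ N>0) (subst (+ 0 ≤_) (sym (⟪y,z⟫ y)) (≥0+≥0 (≥0*≥0 (ℤₚ.<⇒≤ α>0) yw) (≥0*≥0 xw yc≥0))))))
  go : Tri (+ 0 < ⟪ z , perp x ⟫) (+ 0 ≡ ⟪ z , perp x ⟫) (⟪ z , perp x ⟫ < + 0) → _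
  go (tri< k>0 _ _) = perp x , inj₁ refl , close (perp x) _ k>0 yz
  go (tri≈ _ e _) = ⊥-elim (ℤₚ.<-irrefl refl (subst (+ 0 <_) (trans (yz τ) (cong (_* ⟪ τ , perp x ⟫) (sym e))) (>0*>0 N>0 τz>0)))
  go (tri> _ _ k<0) = neg (perp x) , inj₂ refl , close (neg (perp x)) (- ⟪ z , perp x ⟫) (<0⇒->0 k<0)
     λ y → trans (yz y) (trans (lem ⟪ z , perp x ⟫ ⟪ y , perp x ⟫) (cong (- ⟪ z , perp x ⟫ *_) (sym (⟪⟫-negʳ y (perp x)))))
    where
    lem : ∀ a b → a * b ≡ - a * - b
    lem = solve-∀

-- Finite lists: counting, sublists, saturation

module _ {A : Set} where

  length-filter-mono : {P Q : A → Set} (P? : Decidable P) (Q? : Decidable Q) → (∀ x → P x → Q x) →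
                       ∀ xs → length (filter P? xs) ℕ.≤ length (filter Q? xs)
  length-filter-mono P? Q? P⇒Q [] = ℕ.z≤n
  length-filter-mono P? Q? P⇒Q (x ∷ xs) with P? x | Q? x
  ... | yes p | yes q = ℕ.s≤s (length-filter-mono P? Q? P⇒Q xs)
  ... | yes p | no ¬q = ⊥-elim (¬q (P⇒Q x p))
  ... | no ¬p | yes q = ℕₚ.m≤n⇒m≤1+n (length-filter-mono P? Q? P⇒Q xs)
  ... | no ¬p | no ¬q = length-filter-mono P? Q? P⇒Q xs

  length-filter-mono-< : {P Q : A → Set} (P? : Decidable P) (Q? : Decidable Q) → (∀ x → P x → Q x) →
                         ∀ {xs y} → y ∈ xs → ¬ P y → Q y → length (filter P? xs) ℕ.< length (filter Q? xs)
  length-filter-mono-< P? Q? P⇒Q {x ∷ xs} (here refl) ¬py qy with P? x | Q? x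
  ... | yes p | _ = ⊥-elim (¬py p)
  ... | no _ | no ¬q = ⊥-elim (¬q qy)
  ... | no _ | yes _ = ℕ.s≤s (length-filter-mono P? Q? P⇒Q xs)
  length-filter-mono-< P? Q? P⇒Q {x ∷ xs} (there y∈) ¬py qy with P? x | Q? x
  ... | yes p | yes q = ℕ.s≤s (length-filter-mono-< P? Q? P⇒Q y∈ ¬py qy)
  ... | yes p | no ¬q = ⊥-elim (¬q (P⇒Q x p))
  ... | no ¬p | yes q = ℕₚ.m≤n⇒m≤1+n (length-filter-mono-< P? Q? P⇒Q y∈ ¬py qy)
  ... | no ¬p | no ¬q = length-filter-mono-< P? Q? P⇒Q y∈ ¬py qy

  length-filter-split : {P : A → Set} (P? : Decidable P) → ∀ xs →
                        length (filter P? xs) ℕ.+ length (filter (¬? ∘ P?) xs) ≡ length xs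
  length-filter-split P? [] = refl
  length-filter-split P? (x ∷ xs) with P? x
  ... | yes p = cong suc (length-filter-split P? xs)
  ... | no ¬p = trans (ℕₚ.+-suc _ _) (cong suc (length-filter-split P? xs))

  -- Finite sets are represented as filters of a fixed list, so that there are finitely many of them
  -- and list equality can serve as equality of states.
  sublists : List A → List (List A)
  sublists [] = [] ∷ []
  sublists (x ∷ xs) = map (x ∷_) (sublists xs) ++ sublists xs

  filter∈sublists : {P : A → Set} (P? : Decidable P) → ∀ xs → filter P? xs ∈ sublists xs
  filter∈sublists P? [] = here refl
  filter∈sublists P? (x ∷ xs) with P? x
  ... | yes _ = ∈-++⁺ˡ (∈-map⁺ (x ∷_) (filter∈sublists P? xs))
  ... | no _ = ∈-++⁺ʳ _ (filter∈sublists P? xs)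

  ∈-sublists : ∀ xs {ys y} → ys ∈ sublists xs → y ∈ ys → y ∈ xs
  ∈-sublists [] (here refl) ()
  ∈-sublists (x ∷ xs) ys∈ y∈ with ∈-++⁻ (map (x ∷_) (sublists xs)) ys∈
  ... | inj₂ q = there (∈-sublists xs q y∈)
  ... | inj₁ q with ∈-map⁻ (x ∷_) q
  ... | zs , zs∈ , refl with y∈
  ... | here e = here e
  ... | there y∈zs = there (∈-sublists xs zs∈ y∈zs)

  listsUpTo : ℕ → List A → List (List A)
  listsUpTo zero xs = [] ∷ []
  listsUpTo (suc n) xs = [] ∷ cartesianProductWith _∷_ xs (listsUpTo n xs)

  ∈-listsUpTo⁺ : ∀ {n xs ys} → length ys ℕ.≤ n → All (_∈ xs) ys → ys ∈ listsUpTo n xs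
  ∈-listsUpTo⁺ {zero} {ys = []} _ _ = here refl
  ∈-listsUpTo⁺ {suc n} {ys = []} _ _ = here refl
  ∈-listsUpTo⁺ {suc n} {ys = y ∷ ys} (ℕ.s≤s h) (y∈ ∷ ys∈) =
    there (∈-cartesianProductWith⁺ _∷_ y∈ (∈-listsUpTo⁺ h ys∈))

  ∈-listsUpTo⁻ : ∀ n {xs ys} → ys ∈ listsUpTo n xs → All (_∈ xs) ys
  ∈-listsUpTo⁻ zero (here refl) = []
  ∈-listsUpTo⁻ (suc n) (here refl) = []
  ∈-listsUpTo⁻ (suc n) {xs} (there q) with ∈-cartesianProductWith⁻ _∷_ xs (listsUpTo n xs) q
  ... | y , ys , y∈ , ys∈ , refl = y∈ ∷ ∈-listsUpTo⁻ n ys∈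

  module _ (_≟_ : DecidableEquality A) where
    open DecMem _≟_ using (_∈?_; _∉?_)

    -- Each addition lowers the number of elements of `L` outside `X`, which bounds the recursion.
    -- `Inv` carries soundness, the last clause is completeness. Reachability, the subset
    -- exploration and finite closures are all computed this way.
    saturate : (L : List A) {Add : List A → A → Set} (Add? : ∀ X p → Dec (Add X p)) {Inv : List A → Set} →
               (∀ {X p} → Inv X → p ∈ L → Add X p → Inv (p ∷ X)) → ∀ X → Inv X →
               ∃[ Y ] (Inv Y × (∀ {x} → x ∈ X → x ∈ Y) × (∀ {p} → p ∈ L → Add Y p → p ∈ Y))
    saturate L {Add} Add? {Inv} preserve X inv = go (length (filter (_∉? X) L)) X ℕₚ.≤-refl inv
      where
      go : ∀ n X → length (filter (_∉? X) L) ℕ.≤ n → Inv X →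
           ∃[ Y ] (Inv Y × (∀ {x} → x ∈ X → x ∈ Y) × (∀ {p} → p ∈ L → Add Y p → p ∈ Y))
      go n X bound inv with any? (λ p → (p ∉? X) ×-dec Add? X p) L
      ... | no none = X , inv , (λ x∈ → x∈) , λ {p} p∈ add → decide p p∈ add
        where
        decide : ∀ p → p ∈ L → Add X p → p ∈ X
        decide p p∈ add with p ∈? X
        ... | yes q = q
        ... | no q = ⊥-elim (none (lose p∈ (q , add)))
      ... | yes some with find some
      ... | p , p∈ , p∉ , add with ℕₚ.<-≤-trans
              (length-filter-mono-< (_∉? (p ∷ X)) (_∉? X) (λ _ q → q ∘ there) p∈ (λ q → q (here refl)) p∉) bound
      go (suc n) X bound inv | yes some | p , p∈ , p∉ , add | ℕ.s≤s lt
        with go n (p ∷ X) lt (preserve inv p∈ add)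
      ... | Y , invY , sub , sat = Y , invY , sub ∘ there , sat

-- Nondeterministic automata with weighted letters

module Automaton {S Λ : Set} (_≟_ : DecidableEquality S) (states : List S) (letters : List Λ) (weight : Λ → ℕ)
  (Trans : S → Λ → S → Set) (Trans? : ∀ s ℓ s′ → Dec (Trans s ℓ s′))
  (target∈ : ∀ {s ℓ s′} → Trans s ℓ s′ → s′ ∈ states) (blank : Λ) (s₀ : S) where

  open DecMem _≟_ using (_∈?_)

  data Path : S → List Λ → S → Set where
    []  : ∀ {s} → Path s [] s
    _∷_ : ∀ {s ℓ s′ w s″} → Trans s ℓ s′ → Path s′ w s″ → Path s (ℓ ∷ w) s″

  Path-++ : ∀ {a w b w′ c} → Path a w b → Path b w′ c → Path a (w ++ w′) c
  Path-++ [] q = q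
  Path-++ (t ∷ p) q = t ∷ Path-++ p q

  Reach : S → S → Set
  Reach a b = ∃[ n ] Path a (replicate n blank) b

  reach-snoc : ∀ {a b c} → Reach a b → Trans b blank c → Reach a c
  reach-snoc {a} {b} {c} (n , p) t = suc n , subst (λ w → Path a w c) (lem n) (Path-++ p (t ∷ []))
    where
    lem : ∀ n → replicate n blank ++ blank ∷ [] ≡ replicate (suc n) blank
    lem zero = refl
    lem (suc n) = cong (blank ∷_) (lem n)

  Reach? : ∀ a b → Dec (Reach a b)
  Reach? a b with saturate _≟_ states {λ X p → Any (λ q → Trans q blank p) X} (λ X p → any? (λ q → Trans? q blank p) X)
                    {All (Reach a)}
                    (λ inv _ add → let q , q∈ , t = find add in reach-snoc (All.lookup inv q∈) t ∷ inv)
                    (a ∷ []) ((0 , []) ∷ [])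
  ... | Y , inv , sub , sat with b ∈? Y
  ... | yes b∈ = yes (All.lookup inv b∈)
  ... | no b∉ = no λ { (n , p) → b∉ (stay n (sub (here refl)) p) }
    where
    stay : ∀ n {c d} → c ∈ Y → Path c (replicate n blank) d → d ∈ Y
    stay zero c∈ [] = c∈
    stay (suc n) c∈ (t ∷ p) = stay n (sat (target∈ t) (lose c∈ t)) p

  -- The blanks before and after the word leave room for a witness that extends further to the left
  -- and to the right than the points encoded by the word.
  Accept : List Λ → Set
  Accept w = ∃[ a ] ∃[ b ] (Reach s₀ a × Path a w b × Reach b s₀)

  totalWeight : List Λ → ℕ
  totalWeight w = sum (map weight w)

  private
    -- `s₀` is added because only targets of transitions are known to lie in `states`.
    Q : List S
    Q = s₀ ∷ states

    Succ? : ∀ A ℓ s′ → Dec (Any (λ s → Trans s ℓ s′) A)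
    Succ? A ℓ s′ = any? (λ s → Trans? s ℓ s′) A

    δ : List S → Λ → List S
    δ A ℓ = filter (Succ? A ℓ) Q

    A₀ : List S
    A₀ = filter (Reach? s₀) Q

    run : List S → List Λ → List S
    run = foldl δ

    run-sound : ∀ w {A s} → s ∈ run A w → ∃[ a ] (a ∈ A × Path a w s)
    run-sound [] {s = s} s∈ = s , s∈ , []
    run-sound (ℓ ∷ w) {A} s∈ with run-sound w s∈
    ... | b , b∈ , p with ∈-filter⁻ (Succ? A ℓ) {xs = Q} b∈
    ... | _ , some with find some
    ... | a , a∈ , t = a , a∈ , t ∷ p

    run-complete : ∀ {w A a s} → a ∈ A → Path a w s → s ∈ run A w
    run-complete a∈ [] = a∈
    run-complete {ℓ ∷ w} {A} a∈ (t ∷ p) = run-complete (∈-filter⁺ (Succ? A ℓ) (there (target∈ t)) (lose a∈ t)) p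

    Live : List S → Set
    Live = Any (λ s → Reach s s₀)

    Live? : ∀ A → Dec (Live A)
    Live? = any? (λ s → Reach? s s₀)

    live⇒accept : ∀ w → Live (run A₀ w) → Accept w
    live⇒accept w live with find live
    ... | b , b∈ , r with run-sound w b∈
    ... | a , a∈ , p = a , b , proj₂ (∈-filter⁻ (Reach? s₀) {xs = Q} a∈) , p , r

    reach∈Q : ∀ n {a b} → a ∈ Q → Path a (replicate n blank) b → b ∈ Q
    reach∈Q zero a∈ [] = a∈
    reach∈Q (suc n) a∈ (t ∷ p) = reach∈Q n (there (target∈ t)) p

    accept⇒live : ∀ w → Accept w → Live (run A₀ w)
    accept⇒live w (a , b , (n , r) , p , r′) =
      lose (run-complete (∈-filter⁺ (Reach? s₀) (reach∈Q n (here refl) r) (n , r)) p) r′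

  Accept? : ∀ w → Dec (Accept w)
  Accept? w = map′ (live⇒accept w) (accept⇒live w) (Live? (run A₀ w))

  Rejected : ℕ → Set
  Rejected k = ∃[ w ] (All (_∈ letters) w × totalWeight w ℕ.≤ k × ¬ Accept w)

  private
    -- A state of the subset construction, with the weight read so far.
    Config : Set
    Config = List S × ℕ

    _≟ᶜ_ : DecidableEquality Config
    _≟ᶜ_ = ≡-dec (Listₚ.≡-dec _≟_) ℕₚ._≟_

    configs : ℕ → List Config
    configs k = cartesianProduct (sublists Q) (upTo (suc k))

    Move : Config → Λ → Config → Set
    Move (A , n) ℓ (A′ , n′) = A′ ≡ δ A ℓ × n′ ≡ n ℕ.+ weight ℓ

    Move? : ∀ c ℓ c′ → Dec (Move c ℓ c′)
    Move? (A , n) ℓ (A′ , n′) = Listₚ.≡-dec _≟_ A′ (δ A ℓ) ×-dec (n′ ℕₚ.≟ n ℕ.+ weight ℓ)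

    Visited : Config → Set
    Visited (A , n) = ∃[ w ] (All (_∈ letters) w × run A₀ w ≡ A × totalWeight w ≡ n)

    visit : ∀ {c ℓ c′} → Visited c → ℓ ∈ letters → Move c ℓ c′ → Visited c′
    visit {A , n} {ℓ} (w , w∈ , refl , refl) ℓ∈ (refl , refl) =
      w ++ ℓ ∷ [] , Allₚ.++⁺ w∈ (ℓ∈ ∷ []) , Listₚ.foldl-++ δ A₀ w (ℓ ∷ []) ,
      trans (cong sum (Listₚ.map-++ weight w (ℓ ∷ [])))
        (trans (sum-++ (map weight w) (weight ℓ ∷ [])) (cong (sum (map weight w) ℕ.+_) (ℕₚ.+-identityʳ _)))

    -- Configurations of weight at most `k` are finite in number although the words leading to them
    -- are not; each visited one keeps such a word, which serves as the rejected word if the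
    -- configuration is dead.
    Explored : ℕ → List Config → Set
    Explored k Y = All (λ c → Visited c × proj₂ c ℕ.≤ k) Y × (A₀ , 0) ∈ Y ×
                   (∀ {c c′ ℓ} → c ∈ Y → ℓ ∈ letters → Move c ℓ c′ → c′ ∈ configs k → c′ ∈ Y)

    explore : ∀ k → ∃ (Explored k)
    explore k =
      let Y , inv , sub , sat = saturate _≟ᶜ_ (configs k) (λ X c′ → any? (λ c → any? (λ ℓ → Move? c ℓ c′) letters) X)
            {All (λ c → Visited c × proj₂ c ℕ.≤ k)}
            (λ inv c′∈ add → let c , c∈ , some = find add
                                 ℓ , ℓ∈ , m = find some
                             in (visit (proj₁ (All.lookup inv c∈)) ℓ∈ m
                                , ℕₚ.≤-pred (∈-upTo⁻ (proj₂ (∈-cartesianProduct⁻ (sublists Q) _ c′∈)))) ∷ inv)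
            ((A₀ , 0) ∷ []) ((([] , [] , refl , refl) , ℕ.z≤n) ∷ [])
      in Y , inv , sub (here refl) , λ c∈ ℓ∈ m c′∈ → sat c′∈ (lose c∈ (lose ℓ∈ m))

    -- Weights are natural numbers, so every prefix of a word of weight at most `k` also stays
    -- within `configs k`.
    explored-run : ∀ {k Y} → Explored k Y → ∀ w {A n} → (A , n) ∈ Y → All (_∈ letters) w →
                   n ℕ.+ totalWeight w ℕ.≤ k → ∃[ n′ ] (run A w , n′) ∈ Y
    explored-run ex [] {n = n} c∈ _ _ = n , c∈
    explored-run {k} ex@(_ , _ , step) (ℓ ∷ w) {A} {n} c∈ (ℓ∈ ∷ w∈) le =
      explored-run ex w
        (step c∈ ℓ∈ (refl , refl)
          (∈-cartesianProduct⁺ (filter∈sublists (Succ? A ℓ) Q) (∈-upTo⁺ (ℕ.s≤s (ℕₚ.≤-trans (ℕₚ.m≤m+n _ _) le′)))))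
        w∈ le′
      where
      le′ : n ℕ.+ weight ℓ ℕ.+ totalWeight w ℕ.≤ k
      le′ = subst (ℕ._≤ k) (sym (ℕₚ.+-assoc n (weight ℓ) (totalWeight w))) le

    rejected-from : ∀ {k Y} → Explored k Y → Dec (Any (λ c → ¬ Live (proj₁ c)) Y) → Dec (Rejected k)
    rejected-from (inv , start , _) (yes bad) =
      let c , c∈ , dead = find bad
          (w , w∈ , run≡ , weight≡) , n≤k = All.lookup inv c∈
      in yes (w , w∈ , subst (ℕ._≤ _) (sym weight≡) n≤k , λ acc → dead (subst Live run≡ (accept⇒live w acc)))
    rejected-from ex@(inv , start , _) (no good) = no λ { (w , w∈ , le , rej) →
      let n , c∈ = explored-run ex w start w∈ le in good (lose c∈ (λ live → rej (live⇒accept w live))) }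

  Rejected? : ∀ k → Dec (Rejected k)
  Rejected? k = rejected-from (proj₂ (explore k)) (any? (λ c → ¬? (Live? (proj₁ c))) (proj₁ (explore k)))

-- Points and boxes

_≟ₚ_ : DecidableEquality Point
_≟ₚ_ = ≡-dec ℤₚ._≟_ ℤₚ._≟_

open DecMem _≟ₚ_ using (_∈?_)

absBound : {A : Set} → (A → ℤ) → List A → ℕ
absBound f xs = sum (map (∣_∣ ∘ f) xs)

∈⇒≤sum : ∀ {A : Set} (f : A → ℕ) {xs x} → x ∈ xs → f x ℕ.≤ sum (map f xs)
∈⇒≤sum f {x ∷ xs} (here refl) = ℕₚ.m≤m+n (f x) _
∈⇒≤sum f {x ∷ xs} (there x∈) = ℕₚ.≤-trans (∈⇒≤sum f x∈) (ℕₚ.m≤n+m _ (f x))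

≤absBound : ∀ {A : Set} (f : A → ℤ) {xs x} → x ∈ xs → ∣ f x ∣ ℕ.≤ absBound f xs
≤absBound f = ∈⇒≤sum (∣_∣ ∘ f)

range : ℕ → List ℤ
range n = map +_ (upTo (suc n)) ++ map -[1+_] (upTo n)

∈-range : ∀ a {n} → ∣ a ∣ ℕ.≤ n → a ∈ range n
∈-range (+ m) h = ∈-++⁺ˡ (∈-map⁺ +_ (∈-upTo⁺ (ℕ.s≤s h)))
∈-range -[1+ m ] {n} h = ∈-++⁺ʳ (map +_ (upTo (suc n))) (∈-map⁺ -[1+_] (∈-upTo⁺ h))

box : ℕ → List Point
box n = cartesianProduct (range n) (range n)

∈-box : ∀ {x n} → ∣ proj₁ x ∣ ℕ.≤ n → ∣ proj₂ x ∣ ℕ.≤ n → x ∈ box n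
∈-box {a , b} p q = ∈-cartesianProduct⁺ (∈-range a p) (∈-range b q)

-- Closures

Fires : UpdateFamily → (Point → Set) → Point → Set
Fires 𝒰 A x = Any (λ U → All (λ o → A (x ⊕ o)) U) 𝒰

Closed : UpdateFamily → (Point → Set) → Set
Closed 𝒰 A = ∀ x → Fires 𝒰 A x → A x

fires-map : ∀ {𝒰} A B x → (∀ o → A (x ⊕ o) → B (x ⊕ o)) → Fires 𝒰 A x → Fires 𝒰 B x
fires-map A B x f = Any.map (All.map λ {o} → f o)

fires-map-∈ : ∀ {𝒰} A B x → (∀ o → o ∈ concat 𝒰 → A (x ⊕ o) → B (x ⊕ o)) → Fires 𝒰 A x → Fires 𝒰 B x
fires-map-∈ A B x f fires =
  let U , U∈ , all = find fires
  in lose U∈ (All.tabulate λ {o} o∈ → f o (∈-concat⁺′ o∈ U∈) (All.lookup all o∈))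

fires? : ∀ 𝒰 {A} → Decidable A → ∀ x → Dec (Fires 𝒰 A x)
fires? 𝒰 A? x = any? (All.all? (λ o → A? (x ⊕ o))) 𝒰

iter⊆closed : ∀ {𝒰 A B} → Closed 𝒰 B → (∀ x → A x → B x) → ∀ t x → Iter 𝒰 A t x → B x
iter⊆closed closed A⊆B zero x h = A⊆B x h
iter⊆closed closed A⊆B (suc t) x (inj₁ h) = iter⊆closed closed A⊆B t x h
iter⊆closed {𝒰} {A} {B} closed A⊆B (suc t) x (inj₂ h) = closed x (fires-map (Iter 𝒰 A t) B x (λ o → iter⊆closed closed A⊆B t (x ⊕ o)) h)

closure⊆closed : ∀ {𝒰 A B} → Closed 𝒰 B → (∀ x → A x → B x) → ∀ x → Closure 𝒰 A x → B x
closure⊆closed closed A⊆B x (t , h) = iter⊆closed closed A⊆B t x h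

iter-mono : ∀ {𝒰 A s t x} → s ℕ.≤ t → Iter 𝒰 A s x → Iter 𝒰 A t x
iter-mono {𝒰} {A} {s} {t} {x} s≤t h = go (ℕₚ.≤⇒≤′ s≤t)
  where
  go : ∀ {t} → s ℕ.≤′ t → Iter 𝒰 A t x
  go (ℕ.≤′-reflexive refl) = h
  go (ℕ.≤′-step q) = inj₁ (go q)

-- A rule is finite, so the times at which its points become infected have a common bound.
closure-closed : ∀ 𝒰 A → Closed 𝒰 (Closure 𝒰 A)
closure-closed 𝒰 A x fires =
  let U , U∈ , all = find fires
      t , h = common U all
  in suc t , inj₂ (lose U∈ h)
  where
  common : ∀ U → All (λ o → Closure 𝒰 A (x ⊕ o)) U → ∃[ t ] All (λ o → Iter 𝒰 A t (x ⊕ o)) U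
  common [] [] = 0 , []
  common (o ∷ U) ((s , h) ∷ hs) =
    let t , h′ = common U hs
    in s ℕ.⊔ t , iter-mono (ℕₚ.m≤m⊔n s t) h ∷ All.map (iter-mono (ℕₚ.m≤n⊔m s t)) h′

unstable? : ∀ 𝒰 u → Dec (Unstable 𝒰 u)
unstable? 𝒰 u = any? (All.all? (λ x → ⟪ x , vec u ⟫ ℤₚ.<? + 0)) 𝒰

-- If a rule infected a point of height at least `a` from heights below `a`, all its elements would
-- have negative product with `u`, against stability.
stable-below : ∀ {𝒰} u → Stable 𝒰 u → ∀ a z → Fires 𝒰 (λ y → ⟪ y , vec u ⟫ < a) z → ⟪ z , vec u ⟫ < a
stable-below u st a z fires with ⟪ z , vec u ⟫ ℤₚ.<? a
... | yes h = h
... | no h = ⊥-elim (st (Any.map (All.map λ {o} q → <-by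
      (>0+≥0 (diff>0 (subst (_< a) (⟪⟫-⊕ˡ z o (vec u)) q)) (diff≥0 (ℤₚ.≮⇒≥ h))) (lem a ⟪ z , vec u ⟫ ⟪ o , vec u ⟫)) fires))
  where
  lem : ∀ a z o → + 0 - o ≡ (a - (z + o)) + (z - a)
  lem = solve-∀

Infected : Direction → List Point → Point → Set
Infected u X y = InH u y ⊎ y ∈ X

infected? : ∀ u X → Decidable (Infected u X)
infected? u X y = (⟪ y , vec u ⟫ ℤₚ.<? + 0) ⊎-dec (y ∈? X)

Closable : UpdateFamily → Direction → List Point → Set
Closable 𝒰 u Z = ∃[ X ] (Closed 𝒰 (Infected u X) × (∀ {z} → z ∈ Z → z ∈ X))

closable⇒finite : ∀ {𝒰 u Z} → Closable 𝒰 u Z → FiniteSet (ZBar 𝒰 u Z)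
closable⇒finite {u = u} (X , closed , Z⊆X) = X , λ x (inC , notH) →
  Sum.[ (λ h → ⊥-elim (notH h)) , (λ h → h) ] (closure⊆closed closed (λ _ → Sum.map₂ Z⊆X) x inC)

-- `Z` is saturated inside the list covering the closure. Every added point belongs to the closure,
-- so a rule that fires outside the half-plane fires in `L`, where saturation applies.
finite⇒closable : ∀ {𝒰 u Z} → All (λ z → ¬ InH u z) Z → FiniteSet (ZBar 𝒰 u Z) → Closable 𝒰 u Z
finite⇒closable {𝒰} {u} {Z} Z∌H (L , cover) =
  let X , inv , Z⊆X , sat = saturate _≟ₚ_ L {λ X p → ¬ InH u p × Fires 𝒰 (Infected u X) p}
        (λ X p → ¬? (⟪ p , vec u ⟫ ℤₚ.<? + 0) ×-dec fires? 𝒰 (infected? u X) p)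
        {All (ZBar 𝒰 u Z)} (λ inv _ (notH , fires) → (fired inv fires , notH) ∷ inv) Z
        (All.tabulate λ z∈ → (0 , inj₂ z∈) , All.lookup Z∌H z∈)
  in X , (λ x fires → decide X inv sat x fires (⟪ x , vec u ⟫ ℤₚ.<? + 0)) , Z⊆X
  where
  fired : ∀ {X p} → All (ZBar 𝒰 u Z) X → Fires 𝒰 (Infected u X) p → Closure 𝒰 (λ y → InH u y ⊎ y ∈ Z) p
  fired {X} {p} inv fires = closure-closed 𝒰 _ p
    (fires-map (Infected u X) (Closure 𝒰 (λ y → InH u y ⊎ y ∈ Z)) p (λ o → Sum.[ (λ h → 0 , inj₁ h) , (λ h → proj₁ (All.lookup inv h)) ]) fires)
  decide : ∀ X → All (ZBar 𝒰 u Z) X → (∀ {p} → p ∈ L → ¬ InH u p × Fires 𝒰 (Infected u X) p → p ∈ X) →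
           ∀ x → Fires 𝒰 (Infected u X) x → Dec (InH u x) → Infected u X x
  decide X inv sat x fires (yes h) = inj₁ h
  decide X inv sat x fires (no h) = inj₂ (sat (cover x (fired inv fires , h)) (h , fires))

-- Candidate directions

-- Every open semicircle contains one of these, which gives each sweep a candidate to start from.
axes : List Direction
axes = ((+ 1 , + 0) , λ ()) ∷ ((-[1+ 0 ] , + 0) , λ ()) ∷ ((+ 0 , + 1) , λ ()) ∷ ((+ 0 , -[1+ 0 ]) , λ ()) ∷ []

normals : Point → List Direction
normals x with x ≟ₚ origin
... | yes _ = []
... | no x≢0 = (perp x , perp≢0 x≢0) ∷ (neg (perp x) , neg≢0 (perp≢0 x≢0)) ∷ []

candidates : List Point → List Direction
candidates xs = axes ++ concatMap normals xs

axis-towards : ∀ v → v ≢ origin → ∃[ e ] (e ∈ axes × + 0 < ⟪ vec e , v ⟫)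
axis-towards (a , b) v≢0 with ℤₚ.<-cmp (+ 0) a | ℤₚ.<-cmp (+ 0) b
... | tri< a>0 _ _ | _ = _ , here refl , subst (+ 0 <_) (lem a b) a>0
  where
  lem : ∀ a b → a ≡ + 1 * a + + 0 * b
  lem = solve-∀
... | tri> _ _ a<0 | _ = _ , there (here refl) , subst (+ 0 <_) (lem a b) (<0⇒->0 a<0)
  where
  lem : ∀ a b → - a ≡ - (+ 1) * a + + 0 * b
  lem = solve-∀
... | tri≈ _ _ _ | tri< b>0 _ _ = _ , there (there (here refl)) , subst (+ 0 <_) (lem a b) b>0
  where
  lem : ∀ a b → b ≡ + 0 * a + + 1 * b
  lem = solve-∀
... | tri≈ _ _ _ | tri> _ _ b<0 = _ , there (there (there (here refl))) , subst (+ 0 <_) (lem a b) (<0⇒->0 b<0)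
  where
  lem : ∀ a b → - b ≡ + 0 * a + - (+ 1) * b
  lem = solve-∀
... | tri≈ _ refl _ | tri≈ _ refl _ = ⊥-elim (v≢0 refl)

normal∈ : ∀ {xs x c} → x ∈ xs → x ≢ origin → c ≡ perp x ⊎ c ≡ neg (perp x) → ∃[ d ] (d ∈ candidates xs × vec d ≡ c)
normal∈ {xs} {x} {c} x∈ x≢0 c≡ = let d , d∈ , e = in-normals c≡ in d , ∈-++⁺ʳ axes (∈-concatMap⁺ normals (lose x∈ d∈)) , e
  where
  in-normals : c ≡ perp x ⊎ c ≡ neg (perp x) → ∃[ d ] (d ∈ normals x × vec d ≡ c)
  in-normals c≡ with x ≟ₚ origin
  in-normals c≡ | yes x≡0 = ⊥-elim (x≢0 x≡0)
  in-normals (inj₁ e) | no _ = _ , here refl , sym e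
  in-normals (inj₂ e) | no _ = _ , there (here refl) , sym e

-- Rotate c towards w, passing from one candidate to the next; each turn strictly decreases the number of
-- x in xs whose orthogonal line separates c from w.
sweep : ∀ {G : Set} xs w τ → + 0 < ⟪ w , τ ⟫ →
        (∀ c → c ∈ candidates xs → + 0 < ⟪ vec c , τ ⟫ → G ⊎ ∃[ x ] (x ∈ xs × + 0 ≤ ⟪ x , w ⟫ × ⟪ x , vec c ⟫ < + 0)) → G
sweep {G} xs w τ wτ step =
  let e , e∈ , eτ = axis-towards τ (nonzero-by {τ} {w} (subst (+ 0 <_) (⟪⟫-comm w τ) wτ))
  in go _ e (∈-++⁺ˡ e∈) eτ ℕₚ.≤-refl
  where
  Separates : Direction → Point → Set
  Separates c x = + 0 ≤ ⟪ x , w ⟫ × ⟪ x , vec c ⟫ < + 0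
  separates? : ∀ c → Decidable (Separates c)
  separates? c x = (+ 0 ℤₚ.≤? ⟪ x , w ⟫) ×-dec (⟪ x , vec c ⟫ ℤₚ.<? + 0)
  go : ∀ n c → c ∈ candidates xs → + 0 < ⟪ vec c , τ ⟫ → length (filter (separates? c) xs) ℕ.≤ n → G
  go n c c∈ cτ le with step c c∈ cτ
  ... | inj₁ g = g
  ... | inj₂ (x , x∈ , xw , xc) with turn x w (vec c) τ xw xc wτ cτ
  ... | c′ , c′≡ , c′τ , xc′ , between
    with normal∈ x∈ (λ { refl → ℤₚ.<-irrefl (⟪origin⟫ (vec c)) xc }) c′≡
  ... | d , d∈ , refl with ℕₚ.<-≤-trans (length-filter-mono-< (separates? d) (separates? c)
          (λ y (yw , yd) → yw , between y yw yd) x∈ (λ (_ , xd) → ℤₚ.<-irrefl xc′ xd) (xw , xc)) le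
  go (suc n) c c∈ cτ le | inj₂ _ | _ , _ , c′τ , _ | d , d∈ , refl | ℕ.s≤s lt = go n d d∈ c′τ lt

-- Coordinate bounds

CoordsWithin : ℕ → Point → Set
CoordsWithin m x = ∣ proj₁ x ∣ ℕ.≤ m × ∣ proj₂ x ∣ ℕ.≤ m

coordBound : List Point → ℕ
coordBound xs = absBound proj₁ xs ℕ.+ absBound proj₂ xs

∈⇒coordsWithin : ∀ {xs x} → x ∈ xs → CoordsWithin (coordBound xs) x
∈⇒coordsWithin x∈ = ℕₚ.≤-trans (≤absBound proj₁ x∈) (ℕₚ.m≤m+n _ _) , ℕₚ.≤-trans (≤absBound proj₂ x∈) (ℕₚ.m≤n+m _ _)

abs-*-≤ : ∀ a b {m n} → ∣ a ∣ ℕ.≤ m → ∣ b ∣ ℕ.≤ n → ∣ a * b ∣ ℕ.≤ m ℕ.* n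
abs-*-≤ a b p q = ℕₚ.≤-trans (ℕₚ.≤-reflexive (ℤₚ.abs-* a b)) (ℕₚ.*-mono-≤ p q)

abs-+-≤ : ∀ a b {m n} → ∣ a ∣ ℕ.≤ m → ∣ b ∣ ℕ.≤ n → ∣ a + b ∣ ℕ.≤ m ℕ.+ n
abs-+-≤ a b p q = ℕₚ.≤-trans (ℤₚ.∣i+j∣≤∣i∣+∣j∣ a b) (ℕₚ.+-mono-≤ p q)

abs---≤ : ∀ a b {m n} → ∣ a ∣ ℕ.≤ m → ∣ b ∣ ℕ.≤ n → ∣ a - b ∣ ℕ.≤ m ℕ.+ n
abs---≤ a b p q = ℕₚ.≤-trans (ℤₚ.∣i-j∣≤∣i∣+∣j∣ a b) (ℕₚ.+-mono-≤ p q)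

abs-⟪⟫-≤ : ∀ x y {m n} → CoordsWithin m x → CoordsWithin n y → ∣ ⟪ x , y ⟫ ∣ ℕ.≤ m ℕ.* n ℕ.+ m ℕ.* n
abs-⟪⟫-≤ (a , b) (c , d) (p , q) (r , s) = abs-+-≤ (a * c) (b * d) (abs-*-≤ a c p r) (abs-*-≤ b d q s)

∣a∣≤∣k*a∣ : ∀ k a → k ≢ + 0 → ∣ a ∣ ℕ.≤ ∣ k * a ∣
∣a∣≤∣k*a∣ k a k≢0 = ℕₚ.≤-trans (ℕₚ.m≤n*m ∣ a ∣ ∣ k ∣ {{ℕ.≢-nonZero λ e → k≢0 (ℤₚ.∣i∣≡0⇒i≡0 e)}}) (ℕₚ.≤-reflexive (sym (ℤₚ.abs-* k a)))

-- The determinant is a nonzero integer, hence at least 1 in absolute value, so a bound on the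
-- numerator in Cramer's rule already bounds the coordinate.
cramer : ∀ s₀ s₁ x {m A B} → CoordsWithin m s₀ → CoordsWithin m s₁ → ⟪ s₁ , perp s₀ ⟫ ≢ + 0 →
         ∣ ⟪ x , s₀ ⟫ ∣ ℕ.≤ A → ∣ ⟪ x , s₁ ⟫ ∣ ℕ.≤ B → CoordsWithin (A ℕ.* m ℕ.+ B ℕ.* m) x
cramer (p , q) (r , t) (x , y) {m} {A} {B} (p≤ , q≤) (r≤ , t≤) κ≢0 a≤ b≤ =
    ℕₚ.≤-trans (∣a∣≤∣k*a∣ κ x κ≢0) (subst (λ e → ∣ e ∣ ℕ.≤ A ℕ.* m ℕ.+ B ℕ.* m) (sym (lem₁ p q r t x y))
      (abs---≤ (a * t) (b * q) (abs-*-≤ a t a≤ t≤) (abs-*-≤ b q b≤ q≤)))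
  , ℕₚ.≤-trans (∣a∣≤∣k*a∣ κ y κ≢0) (subst (λ e → ∣ e ∣ ℕ.≤ A ℕ.* m ℕ.+ B ℕ.* m) (sym (lem₂ p q r t x y))
      (ℕₚ.≤-trans (abs---≤ (b * p) (a * r) (abs-*-≤ b p b≤ p≤) (abs-*-≤ a r a≤ r≤)) (ℕₚ.≤-reflexive (ℕₚ.+-comm (B ℕ.* m) (A ℕ.* m)))))
  where
  κ a b : ℤ
  κ = ⟪ (r , t) , perp (p , q) ⟫
  a = ⟪ (x , y) , (p , q) ⟫
  b = ⟪ (x , y) , (r , t) ⟫
  lem₁ : ∀ p q r t x y → (r * - q + t * p) * x ≡ (x * p + y * q) * t - (x * r + y * t) * q
  lem₁ = solve-∀
  lem₂ : ∀ p q r t x y → (r * - q + t * p) * y ≡ (x * r + y * t) * p - (x * p + y * q) * r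
  lem₂ = solve-∀

infixl 6 _⊖_
_⊖_ : Point → Point → Point
(a , b) ⊖ (c , d) = (a - c , b - d)

⟪⟫-⊖ˡ : ∀ x y u → ⟪ x ⊖ y , u ⟫ ≡ ⟪ x , u ⟫ - ⟪ y , u ⟫
⟪⟫-⊖ˡ (a , b) (c , d) (e , f) = lem a b c d e f where
  lem : ∀ a b c d e f → (a - c) * e + (b - d) * f ≡ (a * e + b * f) - (c * e + d * f)
  lem = solve-∀

⊖-⊕-cancel : ∀ x c → (x ⊖ c) ⊕ c ≡ x
⊖-⊕-cancel (a , b) (c , d) = cong₂ _,_ (lem a c) (lem b d) where
  lem : ∀ a c → a - c + c ≡ a
  lem = solve-∀

⊕-⊖-comm : ∀ x o c → (x ⊕ o) ⊖ c ≡ (x ⊖ c) ⊕ o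
⊕-⊖-comm (a , b) (e , f) (c , d) = cong₂ _,_ (lem a e c) (lem b f d) where
  lem : ∀ a e c → a + e - c ≡ a - c + e
  lem = solve-∀

-- Droplets: finite closed sets around given points

module Droplets (𝒰 : UpdateFamily) (S : List Direction) where

  M R : ℕ
  M = coordBound (map vec S)
  R = coordBound (concat 𝒰)

  -- The bound from `cramer` when the two products are at most `n` and `n + n (M M + M M)` in
  -- absolute value.
  radius : ℕ → ℕ
  radius n = n ℕ.* M ℕ.+ (n ℕ.+ n ℕ.* (M ℕ.* M ℕ.+ M ℕ.* M)) ℕ.* M

  -- Droplets of size `n` that one rule can touch together have centres at most this far apart in
  -- each coordinate.
  reach : ℕ → ℕ
  reach n = (radius n ℕ.+ radius n) ℕ.+ (R ℕ.+ R)

  -- The added term bounds the change of any product with a normal when the centre moves by at most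
  -- `reach n` in each coordinate.
  grow : ℕ → ℕ
  grow n = n ℕ.+ (reach n ℕ.* M ℕ.+ reach n ℕ.* M)

  growIter : ℕ → ℕ → ℕ
  growIter zero n = n
  growIter (suc m) n = growIter m (grow n)

  spread : ℕ → ℕ
  spread k = radius (growIter k 1)

  ≤growIter : ∀ m n → n ℕ.≤ growIter m n
  ≤growIter zero n = ℕₚ.≤-refl
  ≤growIter (suc m) n = ℕₚ.≤-trans (ℕₚ.m≤m+n n _) (≤growIter m (grow n))

  radius-mono : ∀ {m n} → m ℕ.≤ n → radius m ℕ.≤ radius n
  radius-mono h = ℕₚ.+-mono-≤ (ℕₚ.*-monoˡ-≤ M h) (ℕₚ.*-monoˡ-≤ M (ℕₚ.+-mono-≤ h (ℕₚ.*-monoˡ-≤ (M ℕ.* M ℕ.+ M ℕ.* M) h)))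

  InDroplet : ℕ → Point → Set
  InDroplet n x = All (λ s → ⟪ x , vec s ⟫ < + n) S

  inDroplet? : ∀ n x → Dec (InDroplet n x)
  inDroplet? n x = All.all? (λ s → ⟪ x , vec s ⟫ ℤₚ.<? + n) S

  Near : ℕ → Point → Point → Set
  Near T c c′ = CoordsWithin T (c ⊖ c′)

  near? : ∀ T c c′ → Dec (Near T c c′)
  near? T (a , b) (c , d) = (∣ a - c ∣ ℕₚ.≤? T) ×-dec (∣ b - d ∣ ℕₚ.≤? T)

  Far : ℕ → Point → Point → Set
  Far T c c′ = ¬ Near T c c′

  near-sym : ∀ T c c′ → Near T c c′ → Near T c′ c
  near-sym T (a , b) (c , d) (p , q) = subst (ℕ._≤ T) (ℤₚ.∣i-j∣≡∣j-i∣ a c) p , subst (ℕ._≤ T) (ℤₚ.∣i-j∣≡∣j-i∣ b d) q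

  near-refl : ∀ T c → Near T c c
  near-refl T (a , b) = subst (λ e → ∣ e ∣ ℕ.≤ T) (sym (ℤₚ.+-inverseʳ a)) ℕ.z≤n , subst (λ e → ∣ e ∣ ℕ.≤ T) (sym (ℤₚ.+-inverseʳ b)) ℕ.z≤n

  -- Of two near centres one is dropped and none is invented: the surviving droplets stay centred at
  -- points of the original list.
  merge : ∀ T cs → AllPairs (Far T) cs ⊎
          ∃[ cs′ ] (length cs′ ℕ.< length cs × (∀ {c} → c ∈ cs′ → c ∈ cs) × (∀ {c} → c ∈ cs → ∃[ c′ ] (c′ ∈ cs′ × Near T c c′)))
  merge T [] = inj₁ []
  merge T (c ∷ cs) with any? (near? T c) cs
  ... | yes some = let c′ , c′∈ , near = find some in
        inj₂ (cs , ℕₚ.≤-refl , there , λ { (here refl) → c′ , c′∈ , near ; {d} (there d∈) → d , d∈ , near-refl T d })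
  ... | no none with merge T cs
  ... | inj₁ sep = inj₁ (Allₚ.¬Any⇒All¬ cs none ∷ sep)
  ... | inj₂ (cs′ , lt , sub , cover) = inj₂ (c ∷ cs′ , ℕ.s≤s lt , (λ { (here e) → here e ; (there d∈) → there (sub d∈) }) ,
        λ { (here refl) → c , here refl , near-refl T c ; (there d∈) → let c′ , c′∈ , near = cover d∈ in c′ , there c′∈ , near })

  droplet-grow : ∀ n x c c′ → Near (reach n) c c′ → InDroplet n (x ⊖ c) → InDroplet (grow n) (x ⊖ c′)
  droplet-grow n x c c′ near inD = All.tabulate λ {s} s∈ → <-by
    (>0+≥0 (diff>0 (subst (_< + n) (⟪⟫-⊖ˡ x c (vec s)) (All.lookup inD s∈)))
           (diff≥0 (subst (_≤ + e) (⟪⟫-⊖ˡ c c′ (vec s))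
             (proj₂ (abs-bounds _ (abs-⟪⟫-≤ (c ⊖ c′) (vec s) near (∈⇒coordsWithin (∈-map⁺ vec s∈))))))))
    (trans (cong (λ k → + (n ℕ.+ e) - k) (⟪⟫-⊖ˡ x c′ (vec s))) (trans (cong (λ k → k - (⟪ x , vec s ⟫ - ⟪ c′ , vec s ⟫)) (ℤₚ.pos-+ n e))
      (lem (+ n) (+ e) ⟪ x , vec s ⟫ ⟪ c , vec s ⟫ ⟪ c′ , vec s ⟫)))
    where
    e : ℕ
    e = reach n ℕ.* M ℕ.+ reach n ℕ.* M
    lem : ∀ n e x c c′ → n + e - (x - c′) ≡ (n - (x - c)) + (e - (c - c′))
    lem = solve-∀

  -- Larger droplets require a larger distance, so merging must be repeated; each round loses a
  -- centre, which leaves at most `m` rounds.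
  separate : ∀ m cs n → length cs ℕ.≤ m →
             ∃[ cs′ ] ∃[ n′ ] (n′ ℕ.≤ growIter m n × AllPairs (Far (reach n′)) cs′ × (∀ {c} → c ∈ cs′ → c ∈ cs) ×
                               (∀ {c x} → c ∈ cs → InDroplet n (x ⊖ c) → ∃[ c′ ] (c′ ∈ cs′ × InDroplet n′ (x ⊖ c′))))
  separate m cs n le with merge (reach n) cs
  ... | inj₁ sep = cs , n , ≤growIter m n , sep , (λ c∈ → c∈) , λ c∈ inD → _ , c∈ , inD
  separate (suc m) cs n le | inj₂ (cs₁ , lt , sub₁ , cover₁) with separate m cs₁ (grow n) (ℕₚ.≤-pred (ℕₚ.≤-trans lt le))
  ... | cs′ , n′ , n′≤ , sep , sub , cover = cs′ , n′ , n′≤ , sep , (λ c∈ → sub₁ (sub c∈)) ,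
        λ {c} {x} c∈ inD → let c₁ , c₁∈ , near = cover₁ c∈ in cover {x = x} c₁∈ (droplet-grow n x c c₁ near inD)
  separate zero cs n le | inj₂ (cs₁ , lt , _) = ⊥-elim (ℕₚ.n≮0 (ℕₚ.<-≤-trans lt le))

  near⇒≡ : ∀ {T cs c c′} → AllPairs (Far T) cs → c ∈ cs → c′ ∈ cs → Near T c c′ → c ≡ c′
  near⇒≡ (f ∷ fs) (here refl) (here refl) near = refl
  near⇒≡ (f ∷ fs) (here refl) (there c′∈) near = ⊥-elim (All.lookup f c′∈ near)
  near⇒≡ {T} {c = c} {c′} (f ∷ fs) (there c∈) (here refl) near = ⊥-elim (All.lookup f c∈ (near-sym T c c′ near))
  near⇒≡ (f ∷ fs) (there c∈) (there c′∈) near = near⇒≡ fs c∈ c′∈ near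

  module _ (stable : All (Stable 𝒰) S) (meets : ∀ v → v ≢ origin → ∃[ s ] (s ∈ S × + 0 < ⟪ vec s , v ⟫)) where

    -- Choose s₀ with ⟪ s₀ , x ⟫ > 0 and then s₁ with positive product with the normal of s₀ on the side of x:
    -- both products with x are bounded on both sides, and Cramer's rule bounds x.
    droplet-bounded : ∀ n x → InDroplet n x → CoordsWithin (radius n) x
    droplet-bounded n x inD with x ≟ₚ origin
    ... | yes refl = ℕ.z≤n , ℕ.z≤n
    ... | no x≢0 with meets x x≢0
    ... | s₀ , s₀∈ , s₀x with turned (+ 0 ℤₚ.≤? ⟪ x , perp (vec s₀) ⟫)
      where
      p₀≢0 : perp (vec s₀) ≢ origin
      p₀≢0 = perp≢0 (proj₂ s₀)
      turned : Dec (+ 0 ≤ ⟪ x , perp (vec s₀) ⟫) →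
               ∃[ s₁ ] (s₁ ∈ S × ⟪ vec s₁ , perp (vec s₀) ⟫ ≢ + 0 × + 0 ≤ ⟪ x , perp (vec s₀) ⟫ * ⟪ vec s₁ , perp (vec s₀) ⟫)
      turned (yes h) = let s₁ , s₁∈ , s₁v = meets (perp (vec s₀)) p₀≢0 in
        s₁ , s₁∈ , (λ e → ℤₚ.<-irrefl (sym e) s₁v) , ≥0*≥0 h (ℤₚ.<⇒≤ s₁v)
      turned (no h) = let s₁ , s₁∈ , s₁v = meets (neg (perp (vec s₀))) (neg≢0 p₀≢0)
                          s₁v′ = subst (+ 0 <_) (⟪⟫-negʳ (vec s₁) (perp (vec s₀))) s₁v in
        s₁ , s₁∈ , (λ e → ℤₚ.<-irrefl refl (subst (λ k → + 0 < - k) e s₁v′)) ,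
        subst (+ 0 ≤_) (lem ⟪ x , perp (vec s₀) ⟫ ⟪ vec s₁ , perp (vec s₀) ⟫)
          (≥0*≥0 (≤0⇒-≥0 (ℤₚ.<⇒≤ (ℤₚ.≰⇒> h))) (ℤₚ.<⇒≤ s₁v′))
        where
        lem : ∀ a b → - a * - b ≡ a * b
        lem = solve-∀
    ... | s₁ , s₁∈ , κ≢0 , prod≥0 =
        cramer (vec s₀) (vec s₁) x (within s₀∈) (within s₁∈) κ≢0 a-abs
          (bounds-abs b b≥ (ℤₚ.≤-trans (ℤₚ.<⇒≤ (All.lookup inD s₁∈)) (+≤+ (ℕₚ.m≤m+n n _))))
      where
      within : ∀ {s} → s ∈ S → CoordsWithin M (vec s)
      within s∈ = ∈⇒coordsWithin (∈-map⁺ vec s∈)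
      a b q d : ℤ
      a = ⟪ x , vec s₀ ⟫
      b = ⟪ x , vec s₁ ⟫
      q = ⟪ vec s₀ , vec s₀ ⟫
      d = ⟪ vec s₁ , vec s₀ ⟫
      E : ℕ
      E = M ℕ.* M ℕ.+ M ℕ.* M
      a>0 : + 0 < a
      a>0 = subst (+ 0 <_) (⟪⟫-comm (vec s₀) x) s₀x
      a-abs : ∣ a ∣ ℕ.≤ n
      a-abs = bounds-abs a (ℤₚ.≤-trans (ℤₚ.neg-mono-≤ {+ 0} (+≤+ ℕ.z≤n)) (ℤₚ.<⇒≤ a>0)) (ℤₚ.<⇒≤ (All.lookup inD s₀∈))
      -- By `decompose`, `q * b` is `a * d` plus the product that the choice of `s₁` made
      -- nonnegative.
      qb≥ : - (+ (n ℕ.* E)) ≤ q * b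
      qb≥ = ≤-by (≥0+≥0 (diff≥0 (proj₁ (abs-bounds (a * d) (abs-*-≤ a d a-abs (abs-⟪⟫-≤ (vec s₁) (vec s₀) (within s₁∈) (within s₀∈)))))) prod≥0)
        (trans (cong (λ k → k - (- (+ (n ℕ.* E)))) (trans (cong (q *_) (⟪⟫-comm x (vec s₁))) (decompose (vec s₀) (vec s₁) x)))
          (lem (a * d) (⟪ x , perp (vec s₀) ⟫ * ⟪ vec s₁ , perp (vec s₀) ⟫) (- (+ (n ℕ.* E)))))
        where
        lem : ∀ u v w → u + v - w ≡ (u - w) + v
        lem = solve-∀
      b≥ : - (+ (n ℕ.+ n ℕ.* E)) ≤ b
      b≥ with ℤₚ.≤-total (+ 0) b
      ... | inj₁ b≥0 = ℤₚ.≤-trans (ℤₚ.neg-mono-≤ {+ 0} (+≤+ ℕ.z≤n)) b≥0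
      ... | inj₂ b≤0 = ℤₚ.≤-trans (ℤₚ.neg-mono-≤ (+≤+ (ℕₚ.m≤n+m (n ℕ.* E) n)))
             (≤-by (≥0+≥0 (diff≥0 qb≥) (≥0*≥0 (diff≥0 (ℤₚ.i<j⇒suc[i]≤j (norm>0 (vec s₀) (proj₂ s₀)))) (≤0⇒-≥0 b≤0)))
               (lem q b (- (+ (n ℕ.* E)))))
        where
        lem : ∀ q b w → b - w ≡ (q * b - w) + (q - + 1) * - b
        lem = solve-∀

    union : List Point → ℕ → List Point
    union cs n = concatMap (λ c → filter (λ x → inDroplet? n (x ⊖ c)) (map (_⊕ c) (box (radius n)))) cs

    ∈-union⁺ : ∀ {cs n c x} → c ∈ cs → InDroplet n (x ⊖ c) → x ∈ union cs n
    ∈-union⁺ {n = n} {c} {x} c∈ inD = ∈-concatMap⁺ (λ c → filter (λ x → inDroplet? n (x ⊖ c)) (map (_⊕ c) (box (radius n)))) (lose c∈ (∈-filter⁺ (λ x → inDroplet? n (x ⊖ c))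
      (subst (_∈ map (_⊕ c) (box (radius n))) (⊖-⊕-cancel x c)
        (∈-map⁺ (_⊕ c) {x ⊖ c} (let p , q = droplet-bounded n (x ⊖ c) inD in ∈-box {x ⊖ c} p q))) inD))

    ∈-union⁻ : ∀ {cs n x} → x ∈ union cs n → ∃[ c ] (c ∈ cs × InDroplet n (x ⊖ c))
    ∈-union⁻ {n = n} x∈ = let c , c∈ , h = find (∈-concatMap⁻ _ x∈) in
      c , c∈ , proj₂ (∈-filter⁻ (λ x → inDroplet? n (x ⊖ c)) {xs = map (_⊕ c) (box (radius n))} h)

    droplet-closed : ∀ n c → Closed 𝒰 (λ x → InDroplet n (x ⊖ c))
    droplet-closed n c x fires = All.tabulate λ {s} s∈ → stable-below s (All.lookup stable s∈) (+ n) (x ⊖ c)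
      (Any.map (All.map λ {o} inD → subst (λ y → ⟪ y , vec s ⟫ < + n) (⊕-⊖-comm x o c) (All.lookup inD s∈)) fires)

    near-by-rule : ∀ n x o₁ o₂ c₁ c₂ → CoordsWithin R o₁ → CoordsWithin R o₂ →
                   CoordsWithin (radius n) ((x ⊕ o₁) ⊖ c₁) → CoordsWithin (radius n) ((x ⊕ o₂) ⊖ c₂) → Near (reach n) c₁ c₂
    near-by-rule n (x , y) (o , o′) (r , r′) (c , c′) (d , d′) (h₁ , h₁′) (h₂ , h₂′) (h₃ , h₃′) (h₄ , h₄′) =
      one x o r c d h₁ h₂ h₃ h₄ , one y o′ r′ c′ d′ h₁′ h₂′ h₃′ h₄′
      where
      one : ∀ x o r c d → ∣ o ∣ ℕ.≤ R → ∣ r ∣ ℕ.≤ R → ∣ x + o - c ∣ ℕ.≤ radius n → ∣ x + r - d ∣ ℕ.≤ radius n → ∣ c - d ∣ ℕ.≤ reach n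
      one x o r c d p q s t = subst (λ e → ∣ e ∣ ℕ.≤ reach n) (lem x o r c d)
        (abs-+-≤ ((x + r - d) - (x + o - c)) (o - r) (abs---≤ (x + r - d) (x + o - c) t s) (abs---≤ o r p q))
        where
        lem : ∀ x o r c d → ((x + r - d) - (x + o - c)) + (o - r) ≡ c - d
        lem = solve-∀

    -- Points used by one rule lie in droplets with near centres, hence in a single droplet, which
    -- is closed as an intersection of half-planes with stable normals.
    union-closed : ∀ {cs n} → AllPairs (Far (reach n)) cs → Closed 𝒰 (_∈ union cs n)
    union-closed {cs} {n} sep x fires = let U , U∈ , all = find fires in go U U∈ all
      where
      go : ∀ U → U ∈ 𝒰 → All (λ o → x ⊕ o ∈ union cs n) U → x ∈ union cs n
      -- An empty rule would make every direction unstable, but `S` contains a stable one.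
      go [] U∈ _ = let s , s∈ , _ = meets (+ 1 , + 0) λ () in ⊥-elim (All.lookup stable s∈ (lose U∈ []))
      go U@(o₁ ∷ _) U∈ all@(h ∷ _) = let c , c∈ , inD₁ = ∈-union⁻ h in
        ∈-union⁺ c∈ (droplet-closed n c x (lose U∈ (All.tabulate λ {o} o∈ →
          let c′ , c′∈ , inD = ∈-union⁻ (All.lookup all o∈)
          in subst (λ k → InDroplet n ((x ⊕ o) ⊖ k))
               (sym (near⇒≡ sep c∈ c′∈ (near-by-rule n x o₁ o c c′ (∈⇒coordsWithin (∈-concat⁺′ (here refl) U∈))
                  (∈⇒coordsWithin (∈-concat⁺′ o∈ U∈)) (droplet-bounded n ((x ⊕ o₁) ⊖ c) inD₁) (droplet-bounded n ((x ⊕ o) ⊖ c′) inD)))) inD)))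

    -- Size 1 is the least for which the strict inequalities of `InDroplet` hold at the centre; at
    -- most `k` rounds of merging enlarge it to at most `growIter k 1`.
    cover : ∀ k Z → length Z ℕ.≤ k →
            ∃[ Y ] (Closed 𝒰 (_∈ Y) × (∀ {z} → z ∈ Z → z ∈ Y) × (∀ {y} → y ∈ Y → ∃[ z ] (z ∈ Z × CoordsWithin (spread k) (y ⊖ z))))
    cover k Z le = let cs , n , n≤ , sep , sub , covers = separate k Z 1 le in
      union cs n , union-closed sep
      , (λ {z} z∈ → let c , c∈ , inD = covers {z} {z} z∈ (centre z) in ∈-union⁺ {x = z} c∈ inD)
      , λ {y} y∈ → let c , c∈ , inD = ∈-union⁻ y∈
                       p , q = droplet-bounded n (y ⊖ c) inD
                   in c , sub c∈ , ℕₚ.≤-trans p (radius-mono n≤) , ℕₚ.≤-trans q (radius-mono n≤)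
      where
      centre : ∀ z → InDroplet 1 (z ⊖ z)
      centre z = All.tabulate λ {s} _ → subst (_< + 1) (sym (trans (⟪⟫-⊖ˡ z z (vec s)) (ℤₚ.+-inverseʳ ⟪ z , vec s ⟫))) (+<+ (ℕ.s≤s ℕ.z≤n))

-- The strip automaton

-- y is the height above the boundary line of ℍ_u and t the position along it; translation by p preserves y and
-- raises t by N.  A state is the part of X in the window W moved by a multiple of p.  The width T of W is such
-- that a rule applied in the middle part of W, of width N, only looks at the window and at ℍ_u.
module Strip (𝒰 : UpdateFamily) (u : Direction) (h k : ℕ) where

  p : Point
  p = perp (vec u)

  y t : Point → ℤ
  y x = ⟪ x , vec u ⟫
  t x = ⟪ x , p ⟫

  N : ℤ
  N = ⟪ p , p ⟫

  N>0 : + 0 < N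
  N>0 = norm>0 p (perp≢0 (proj₂ u))

  ρ : ℕ
  ρ = absBound t (concat 𝒰)

  T : ℤ
  T = + ρ + + ρ + N

  T>0 : + 0 < T
  T>0 = ≥0+>0 {+ ρ + + ρ} (+≤+ ℕ.z≤n) N>0

  InWindow : Point → Set
  InWindow x = (+ 0 ≤ y x × y x ≤ + h) × (+ 0 ≤ t x × t x < T)

  inWindow? : ∀ x → Dec (InWindow x)
  inWindow? x = ((+ 0 ℤₚ.≤? y x) ×-dec (y x ℤₚ.≤? + h)) ×-dec ((+ 0 ℤₚ.≤? t x) ×-dec (t x ℤₚ.<? T))

  m : ℕ
  m = coordBound (vec u ∷ p ∷ [])

  W : List Point
  W = filter inWindow? (box (h ℕ.* m ℕ.+ ∣ T ∣ ℕ.* m))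

  abs-nonneg-≤ : ∀ {a n} → + 0 ≤ a → a ≤ + n → ∣ a ∣ ℕ.≤ n
  abs-nonneg-≤ (+≤+ _) (+≤+ q) = q

  ∈-W⁺ : ∀ {x} → InWindow x → x ∈ W
  ∈-W⁺ {x} in-W@((y≥0 , y≤h) , (t≥0 , t<T)) = ∈-filter⁺ inWindow?
    (let b₁ , b₂ = cramer (vec u) p x (∈⇒coordsWithin {xs = vec u ∷ p ∷ []} {x = vec u} (here refl)) (∈⇒coordsWithin {xs = vec u ∷ p ∷ []} {x = p} (there (here refl)))
                     (λ e → ℤₚ.<-irrefl (sym e) N>0) (abs-nonneg-≤ y≥0 y≤h)
                     (abs-nonneg-≤ t≥0 (subst (t x ≤_) (sym (ℤₚ.0≤i⇒+∣i∣≡i (ℤₚ.<⇒≤ T>0))) (ℤₚ.<⇒≤ t<T)))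
     in ∈-box {x} b₁ b₂) in-W

  ∈-W⁻ : ∀ {x} → x ∈ W → InWindow x
  ∈-W⁻ x∈ = proj₂ (∈-filter⁻ inWindow? {xs = box (h ℕ.* m ℕ.+ ∣ T ∣ ℕ.* m)} x∈)

  shift : ℤ → Point → Point
  shift i x = x ⊕ (i ⊗ p)

  y-shift : ∀ i x → y (shift i x) ≡ y x
  y-shift i x = trans (⟪⟫-⊕ˡ x (i ⊗ p) (vec u)) (trans (cong (λ e → y x + e) (trans (⟪⟫-⊗ˡ i p (vec u)) (trans (cong (i *_) (perp-orth (vec u))) (ℤₚ.*-zeroʳ i)))) (ℤₚ.+-identityʳ (y x)))

  t-shift : ∀ i x → t (shift i x) ≡ t x + i * N
  t-shift i x = trans (⟪⟫-⊕ˡ x (i ⊗ p) p) (cong (λ e → t x + e) (⟪⟫-⊗ˡ i p p))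

  y-⊕p : ∀ x → y (x ⊕ p) ≡ y x
  y-⊕p x = trans (⟪⟫-⊕ˡ x p (vec u)) (trans (cong (λ e → y x + e) (perp-orth (vec u))) (ℤₚ.+-identityʳ (y x)))

  t-⊕p : ∀ x → t (x ⊕ p) ≡ t x + N
  t-⊕p x = ⟪⟫-⊕ˡ x p p

  shift-⊕p : ∀ i x → shift i (x ⊕ p) ≡ shift (i + + 1) x
  shift-⊕p i (a , b) = cong₂ _,_ (lem a (proj₁ p) i) (lem b (proj₂ p) i)
    where
    lem : ∀ a p i → a + p + i * p ≡ a + (i + + 1) * p
    lem = solve-∀

  shift-⊕ : ∀ i x o → shift i x ⊕ o ≡ shift i (x ⊕ o)
  shift-⊕ i (a , b) (c , d) = cong₂ _,_ (lem a c (i * proj₁ p)) (lem b d (i * proj₂ p))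
    where
    lem : ∀ a c e → a + e + c ≡ a + c + e
    lem = solve-∀

  shift-inverse : ∀ i z → shift i (shift (- i) z) ≡ z
  shift-inverse i (a , b) = cong₂ _,_ (lem a (proj₁ p) i) (lem b (proj₂ p) i)
    where
    lem : ∀ a p i → a + - i * p + i * p ≡ a
    lem = solve-∀

  i≤i*N : ∀ i → + 0 ≤ i → i ≤ i * N
  i≤i*N i i≥0 = ≤-by (≥0*≥0 i≥0 (diff≥0 (ℤₚ.i<j⇒suc[i]≤j N>0))) (lem i N)
    where
    lem : ∀ i n → i * n - i ≡ i * (n - + 1)
    lem = solve-∀

  i*N≤i : ∀ i → i ≤ + 0 → i * N ≤ i
  i*N≤i i i≤0 = ≤-by (≥0*≥0 (≤0⇒-≥0 i≤0) (diff≥0 (ℤₚ.i<j⇒suc[i]≤j N>0))) (lem i N)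
    where
    lem : ∀ i n → i - i * n ≡ - i * (n - + 1)
    lem = solve-∀

  Overlap : List Point → List Point → Set
  Overlap s s′ = All (λ x → t x + N < T → (x ⊕ p ∈ s → x ∈ s′) × (x ∈ s′ → x ⊕ p ∈ s)) W

  -- The whole window is tested, even near its ends. What lies outside counts as uninfected there,
  -- so the test demands nothing that a closed `X` fails to satisfy.
  Local : List Point → Set
  Local s = All (λ x → Fires 𝒰 (Infected u s) x → x ∈ s) W

  -- The letter lists points of the new window, which is why `placed` uses the shift by `i + 1`.
  Trans : List Point → List Point → List Point → Set
  Trans s ℓ s′ = s′ ∈ sublists W × Overlap s s′ × Local s′ × All (_∈ s′) ℓ

  _≟ˢ_ : DecidableEquality (List Point)
  _≟ˢ_ = Listₚ.≡-dec _≟ₚ_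

  Trans? : ∀ s ℓ s′ → Dec (Trans s ℓ s′)
  Trans? s ℓ s′ =
    DecMem._∈?_ _≟ˢ_ s′ (sublists W) ×-dec
    All.all? (λ x → (t x + N ℤₚ.<? T) →-dec ((x ⊕ p ∈? s →-dec x ∈? s′) ×-dec (x ∈? s′ →-dec x ⊕ p ∈? s))) W ×-dec
    All.all? (λ x → fires? 𝒰 (infected? u s′) x →-dec x ∈? s′) W ×-dec
    All.all? (_∈? s′) ℓ

  open Automaton _≟ˢ_ (sublists W) (listsUpTo k W) length Trans Trans? (λ {s} {ℓ} → proj₁) [] [] public

  placed : ℤ → List (List Point) → List Point
  placed i [] = []
  placed i (ℓ ∷ w) = map (shift (i + + 1)) ℓ ++ placed (i + + 1) w

  end : ℤ → List (List Point) → ℤ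
  end i [] = i
  end i (ℓ ∷ w) = end (i + + 1) w

  end-replicate : ∀ n i → end i (replicate n []) ≡ i + + n
  end-replicate zero i = sym (ℤₚ.+-identityʳ i)
  end-replicate (suc n) i = trans (end-replicate n (i + + 1)) (ℤₚ.+-assoc i (+ 1) (+ n))

  placed-replicate : ∀ n i {z} → z ∉ placed i (replicate n [])
  placed-replicate (suc n) i z∈ = placed-replicate n (i + + 1) z∈

  length-placed : ∀ w i → length (placed i w) ≡ totalWeight w
  length-placed [] i = refl
  length-placed (ℓ ∷ w) i = trans (Listₚ.length-++ (map (shift (i + + 1)) ℓ)) (cong₂ ℕ._+_ (Listₚ.length-map _ ℓ) (length-placed w (i + + 1)))

  placed-notH : ∀ w i → All (_∈ listsUpTo k W) w → All (λ z → ¬ InH u z) (placed i w)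
  placed-notH [] i [] = []
  placed-notH (ℓ ∷ w) i (ℓ∈ ∷ w∈) = Allₚ.++⁺ (Allₚ.map⁺ (All.map (λ {x} x∈ yz<0 →
      ℤₚ.<⇒≱ (subst (_< + 0) (y-shift (i + + 1) x) yz<0) (proj₁ (proj₁ (∈-W⁻ x∈)))) (∈-listsUpTo⁻ k ℓ∈)))
    (placed-notH w (i + + 1) w∈)

  -- From a closed set to an accepting run

  module FromClosed (X : List Point) (closed : Closed 𝒰 (Infected u X)) where

    view : ℤ → List Point
    view i = filter (λ x → shift i x ∈? X) W

    ∈-view⁺ : ∀ i {x} → x ∈ W → shift i x ∈ X → x ∈ view i
    ∈-view⁺ i = ∈-filter⁺ (λ x → shift i x ∈? X)

    ∈-view⁻ : ∀ i {x} → x ∈ view i → x ∈ W × shift i x ∈ X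
    ∈-view⁻ i = ∈-filter⁻ (λ x → shift i x ∈? X) {xs = W}

    view-trans : ∀ i ℓ → All (_∈ W) ℓ → (∀ {z} → z ∈ map (shift (i + + 1)) ℓ → z ∈ X) → Trans (view i) ℓ (view (i + + 1))
    view-trans i ℓ ℓ⊆W ℓ⊆X =
        filter∈sublists (λ x → shift (i + + 1) x ∈? X) W
      , All.tabulate (λ {x} x∈ lt →
            (λ xp∈ → ∈-view⁺ (i + + 1) x∈ (subst (_∈ X) (shift-⊕p i x) (proj₂ (∈-view⁻ i xp∈))))
          , λ x∈v → ∈-view⁺ i (∈-W⁺ (next x x∈ lt)) (subst (_∈ X) (sym (shift-⊕p i x)) (proj₂ (∈-view⁻ (i + + 1) x∈v))))
      , All.tabulate (λ {x} x∈ fires → ∈-view⁺ (i + + 1) x∈ (grows x x∈ fires))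
      , All.tabulate (λ {x} x∈ → ∈-view⁺ (i + + 1) (All.lookup ℓ⊆W x∈) (ℓ⊆X (∈-map⁺ (shift (i + + 1)) x∈)))
      where
      next : ∀ x → x ∈ W → t x + N < T → InWindow (x ⊕ p)
      next x x∈ lt = let (y≥0 , y≤h) , (t≥0 , _) = ∈-W⁻ x∈ in
          (subst (+ 0 ≤_) (sym (y-⊕p x)) y≥0 , subst (_≤ + h) (sym (y-⊕p x)) y≤h)
        , (subst (+ 0 ≤_) (sym (t-⊕p x)) (≥0+≥0 t≥0 (ℤₚ.<⇒≤ N>0)) , subst (_< T) (sym (t-⊕p x)) lt)
      grows : ∀ x → x ∈ W → Fires 𝒰 (Infected u (view (i + + 1))) x → shift (i + + 1) x ∈ X
      grows x x∈ fires = Sum.[ (λ h → ⊥-elim (ℤₚ.<⇒≱ (subst (_< + 0) (y-shift (i + + 1) x) h) (proj₁ (proj₁ (∈-W⁻ x∈))))) , (λ h → h) ]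
        (closed (shift (i + + 1) x) (Any.map (All.map λ {o} → moved o) fires))
        where
        moved : ∀ o → Infected u (view (i + + 1)) (x ⊕ o) → Infected u X (shift (i + + 1) x ⊕ o)
        moved o inf = subst (Infected u X) (sym (shift-⊕ (i + + 1) x o))
          (Sum.map (subst (_< + 0) (sym (y-shift (i + + 1) (x ⊕ o)))) (λ h → proj₂ (∈-view⁻ (i + + 1) h)) inf)

    view-path : ∀ w i → All (_∈ listsUpTo k W) w → (∀ {z} → z ∈ placed i w → z ∈ X) → Path (view i) w (view (end i w))
    view-path [] i _ _ = []
    view-path (ℓ ∷ w) i (ℓ∈ ∷ w∈) sub =
      view-trans i ℓ (∈-listsUpTo⁻ k ℓ∈) (λ z∈ → sub (∈-++⁺ˡ z∈)) ∷
      view-path w (i + + 1) w∈ (λ z∈ → sub (∈-++⁺ʳ (map (shift (i + + 1)) ℓ) z∈))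

    blanks∈ : ∀ n → All (_∈ listsUpTo k W) (replicate n [])
    blanks∈ zero = []
    blanks∈ (suc n) = ∈-listsUpTo⁺ ℕ.z≤n [] ∷ blanks∈ n

    view-reach : ∀ i n → Reach (view i) (view (i + + n))
    view-reach i n = n , subst (λ j → Path (view i) (replicate n []) (view j)) (end-replicate n i)
      (view-path (replicate n []) i (blanks∈ n) (λ z∈ → ⊥-elim (placed-replicate n i z∈)))

    b : ℕ
    b = absBound t X

    view-empty : ∀ i → (∀ x → x ∈ W → shift i x ∉ X) → view i ≡ []
    view-empty i none = Listₚ.filter-none (λ x → shift i x ∈? X) (All.tabulate λ {x} → none x)

    view-empty-right : ∀ i → + b < i → view i ≡ []
    view-empty-right i b<i = view-empty i λ x x∈ z∈ →
      let (_ , (t≥0 , _)) = ∈-W⁻ x∈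
          i≥0 = ℤₚ.≤-trans (+≤+ ℕ.z≤n) (ℤₚ.<⇒≤ b<i)
      in ℤₚ.<⇒≱ (<-by (>0+≥0 (>0+≥0 (diff>0 b<i) (diff≥0 (i≤i*N i i≥0))) t≥0)
           (trans (cong (_- + b) (t-shift i x)) (lem (t x) i (i * N) (+ b))))
           (proj₂ (abs-bounds (t (shift i x)) (≤absBound t z∈)))
      where
      lem : ∀ t i e b → t + e - b ≡ ((i - b) + (e - i)) + t
      lem = solve-∀

    view-empty-left : ∀ i → i ≤ - (T + + b) → view i ≡ []
    view-empty-left i i≤ = view-empty i λ x x∈ z∈ →
      let (_ , (_ , t<T)) = ∈-W⁻ x∈
      in ℤₚ.<⇒≱ (<-by (>0+≥0 (>0+≥0 (diff>0 t<T) (diff≥0 (i*N≤i i (ℤₚ.≤-trans i≤ (ℤₚ.neg-mono-≤ {+ 0} (≥0+≥0 (ℤₚ.<⇒≤ T>0) (+≤+ ℕ.z≤n)))))))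
              (diff≥0 i≤)) (trans (cong (λ e → - (+ b) - e) (t-shift i x)) (lem (t x) i (i * N) (+ b) T)))
           (proj₁ (abs-bounds (t (shift i x)) (≤absBound t z∈)))
      where
      lem : ∀ t i e b T → - b - (t + e) ≡ ((T - t) + (i - e)) + (- (T + b) - i)
      lem = solve-∀

    -- `X` is finite and `N` is at least 1, so windows far to the left and far to the right see
    -- nothing of it, and blanks connect them to the word.
    accepted : ∀ w → All (_∈ listsUpTo k W) w → (∀ {z} → z ∈ placed (+ 0) w → z ∈ X) → Accept w
    accepted w w∈ sub =
        view (+ 0) , view (end (+ 0) w)
      , subst₂ Reach (view-empty-left (- (+ a)) (ℤₚ.neg-mono-≤ (ℤₚ.≤-reflexive a≡))) (cong view (ℤₚ.+-inverseˡ (+ a))) (view-reach (- (+ a)) a)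
      , view-path w (+ 0) w∈ sub
      , subst (Reach (view j)) (view-empty-right (j + + c) j+c>b) (view-reach j c)
      where
      a c : ℕ
      a = ∣ T ∣ ℕ.+ b
      j : ℤ
      j = end (+ 0) w
      c = ∣ j ∣ ℕ.+ suc b
      a≡ : T + + b ≡ + a
      a≡ = cong (_+ + b) (sym (ℤₚ.0≤i⇒+∣i∣≡i (ℤₚ.<⇒≤ T>0)))
      j+c>b : + b < j + + c
      j+c>b = <-by (>0+≥0 {+ 1} (+<+ (ℕ.s≤s ℕ.z≤n)) (diff≥0 (proj₁ (abs-bounds j ℕₚ.≤-refl)))) (lem j (+ ∣ j ∣) (+ b))
        where
        lem : ∀ j a b → j + (a + (+ 1 + b)) - b ≡ + 1 + (j - - a)
        lem = solve-∀

  -- From an accepting run to a closed set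

  module FromAccept (stable : Stable 𝒰 u) where

    -- The invariant of a run: X is closed at every point whose rules only look at what has been read.
    record HalfClosed (i : ℤ) (s X : List Point) : Set where
      field
        view⁺ : ∀ {x} → x ∈ s → shift i x ∈ X
        view⁻ : ∀ {x} → x ∈ W → shift i x ∈ X → x ∈ s
        strip : ∀ {z} → z ∈ X → (+ 0 ≤ y z × y z ≤ + h) × t z < i * N + T
        local : ∀ z → t z < i * N + (+ ρ + N) → Fires 𝒰 (Infected u X) z → Infected u X z

    open HalfClosed

    empty : ∀ i → HalfClosed i [] []
    empty i .view⁺ ()
    empty i .view⁻ _ ()
    empty i .strip ()
    empty i .local z _ fires = inj₁ (stable-below u stable (+ 0) z
      (fires-map (Infected u []) (InH u) z (λ o → Sum.[ (λ q → q) , (λ ()) ]) fires))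

    t-offset : ∀ {o} → o ∈ concat 𝒰 → - (+ ρ) ≤ t o × t o ≤ + ρ
    t-offset {o} o∈ = abs-bounds (t o) (≤absBound t o∈)

    -- The heights below `h + 1` form a half-plane that is closed by stability, so no rule leads out
    -- of the strip upwards.
    infected≤h : ∀ {X} → (∀ {z} → z ∈ X → y z ≤ + h) → ∀ z → Fires 𝒰 (Infected u X) z → y z ≤ + h
    infected≤h {X} bound z fires = <suc⇒≤ (stable-below u stable (+ suc h) z
        (fires-map (Infected u X) (λ x → ⟪ x , vec u ⟫ < + suc h) z
          (λ o → Sum.[ (λ q → ℤₚ.<-trans q (+<+ (ℕ.s≤s ℕ.z≤n))) , (λ q → ℤₚ.≤-<-trans (bound q) (+<+ ℕₚ.≤-refl)) ]) fires))
      where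
      <suc⇒≤ : ∀ {a} → a < + suc h → a ≤ + h
      <suc⇒≤ (+<+ q) = +≤+ (ℕₚ.≤-pred q)
      <suc⇒≤ -<+ = -≤+

    step : ∀ {i s ℓ s′ X} → HalfClosed i s X → Trans s ℓ s′ →
           ∃[ X′ ] (HalfClosed (i + + 1) s′ X′ × (∀ {z} → z ∈ X → z ∈ X′) × (∀ {z} → z ∈ map (shift (i + + 1)) ℓ → z ∈ X′))
    step {i} {s} {ℓ} {s′} {X} inv (s′∈ , overlaps , loc , ℓ⊆s′) = X′ , inv′ , ∈-++⁺ʳ new ,
        λ z∈ → let x , x∈ , e = ∈-map⁻ (shift i′) z∈ in subst (_∈ X′) (sym e) (∈-++⁺ˡ (∈-map⁺ (shift i′) (All.lookup ℓ⊆s′ x∈)))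
      where
      i′ : ℤ
      i′ = i + + 1
      new X′ : List Point
      new = map (shift i′) s′
      X′ = new ++ X
      s′⊆W : ∀ {x} → x ∈ s′ → x ∈ W
      s′⊆W = ∈-sublists W s′∈
      -- Left of the old right end, the new window overlaps the old one, whose content is already in
      -- `X`.
      old : ∀ {z} → z ∈ X′ → t z < i * N + T → z ∈ X
      old {z} z∈ t< with ∈-++⁻ new z∈
      ... | inj₂ q = q
      ... | inj₁ q with ∈-map⁻ (shift i′) q
      ... | x , x∈ , refl = subst (_∈ X) (shift-⊕p i x) (view⁺ inv (proj₂ (All.lookup overlaps (s′⊆W x∈)
              (<-by (diff>0 (subst (_< i * N + T) (t-shift i′ x) t<)) (lem (t x) i N T))) x∈))
        where
        lem : ∀ t i n T → T - (t + n) ≡ i * n + T - (t + (i + + 1) * n)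
        lem = solve-∀
      view⁻′ : ∀ {x} → x ∈ W → shift i′ x ∈ X′ → x ∈ s′
      view⁻′ {x} x∈ z∈ with ∈-++⁻ new z∈
      ... | inj₁ q = let x′ , x′∈ , e = ∈-map⁻ (shift i′) q in subst (_∈ s′) (sym (shift-injective e)) x′∈
        where
        shift-injective : ∀ {x′} → shift i′ x ≡ shift i′ x′ → x ≡ x′
        shift-injective {x′} e = trans (sym (back x)) (trans (cong (shift (- i′)) e) (back x′))
          where
          back : ∀ z → shift (- i′) (shift i′ z) ≡ z
          back z = subst (λ j → shift (- i′) (shift j z) ≡ z) (ℤₚ.neg-involutive i′) (shift-inverse (- i′) z)
      ... | inj₂ q = proj₁ (All.lookup overlaps x∈ (<-by (diff>0 (subst (_< i * N + T) (t-shift i′ x) (proj₂ (strip inv q)))) (lem (t x) i N T)))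
              (view⁻ inv (∈-W⁺ ((proj₁ (strip′ q) , proj₂ (strip′ q)) , t≥0 , t<T)) (subst (_∈ X) (sym (shift-⊕p i x)) q))
        where
        lem : ∀ t i n T → T - (t + n) ≡ i * n + T - (t + (i + + 1) * n)
        lem = solve-∀
        strip′ : shift i′ x ∈ X → + 0 ≤ y (x ⊕ p) × y (x ⊕ p) ≤ + h
        strip′ q = let a , b = proj₁ (∈-W⁻ x∈) in subst (+ 0 ≤_) (sym (y-⊕p x)) a , subst (_≤ + h) (sym (y-⊕p x)) b
        t≥0 : + 0 ≤ t (x ⊕ p)
        t≥0 = subst (+ 0 ≤_) (sym (t-⊕p x)) (≥0+≥0 (proj₁ (proj₂ (∈-W⁻ x∈))) (ℤₚ.<⇒≤ N>0))
        t<T : t (x ⊕ p) < T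
        t<T = subst (_< T) (sym (t-⊕p x)) (<-by (diff>0 (subst (_< i * N + T) (t-shift i′ x) (proj₂ (strip inv q)))) (lem (t x) i N T))
      strip′ : ∀ {z} → z ∈ X′ → (+ 0 ≤ y z × y z ≤ + h) × t z < i′ * N + T
      strip′ {z} z∈ with ∈-++⁻ new z∈
      ... | inj₂ q = let a , b = strip inv q in a , <-by (>0+≥0 (diff>0 b) (ℤₚ.<⇒≤ N>0)) (lem (t z) i N T)
        where
        lem : ∀ t i n T → (i + + 1) * n + T - t ≡ (i * n + T - t) + n
        lem = solve-∀
      ... | inj₁ q with ∈-map⁻ (shift i′) q
      ... | x , x∈ , refl = let (a , b) , (_ , c) = ∈-W⁻ (s′⊆W x∈) in
              (subst (+ 0 ≤_) (sym (y-shift i′ x)) a , subst (_≤ + h) (sym (y-shift i′ x)) b)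
            , <-by (diff>0 c) (trans (cong (λ e → i′ * N + T - e) (t-shift i′ x)) (lem (t x) (i′ * N) T))
        where
        lem : ∀ t e T → e + T - (t + e) ≡ T - t
        lem = solve-∀
      local′ : ∀ z → t z < i′ * N + (+ ρ + N) → Fires 𝒰 (Infected u X′) z → Infected u X′ z
      local′ z t< fires with t z ℤₚ.<? i * N + (+ ρ + N)
      ... | yes lt = Sum.map₂ (∈-++⁺ʳ new) (local inv z lt (fires-map-∈ (Infected u X′) (Infected u X) z
              (λ o o∈ → Sum.map₂ λ q → old q (subst (_< i * N + T) (sym (⟪⟫-⊕ˡ z o p))
                (<-by (>0+≥0 (diff>0 lt) (diff≥0 (proj₂ (t-offset o∈)))) (lem (t z) (t o) (i * N) (+ ρ) N)))) fires))
        where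
        lem : ∀ t o e r n → e + (r + r + n) - (t + o) ≡ (e + (r + n) - t) + (r - o)
        lem = solve-∀
      ... | no ge with y z ℤₚ.<? + 0
      ... | yes yz<0 = inj₁ yz<0
      -- Relative to the new window, `ρ ≤ t x < ρ + N`; no rule element leads out of the window
      -- sideways, and `Local` applies.
      ... | no yz≮0 = inj₂ (subst (_∈ X′) (shift-inverse i′ z) (∈-++⁺ˡ (∈-map⁺ (shift i′) {x = x}
              (All.lookup loc (∈-W⁺ ((y≥0 , y≤h) , x≥0 , x<T)) (moved fires)))))
        where
        x : Point
        x = shift (- i′) z
        tx : t x ≡ t z + - i′ * N
        tx = t-shift (- i′) z
        t≥ : + 0 ≤ t z - (i * N + (+ ρ + N))
        t≥ = diff≥0 (ℤₚ.≮⇒≥ ge)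
        y≥0 : + 0 ≤ y x
        y≥0 = subst (+ 0 ≤_) (sym (y-shift (- i′) z)) (ℤₚ.≮⇒≥ yz≮0)
        y≤h : y x ≤ + h
        y≤h = subst (_≤ + h) (sym (y-shift (- i′) z)) (infected≤h (λ q → proj₂ (proj₁ (strip′ q))) z fires)
        x≥ρ : + 0 ≤ t x - + ρ
        x≥ρ = subst (+ 0 ≤_) (sym (trans (cong (_- + ρ) tx) (lem (t z) i (+ ρ) N))) t≥
          where
          lem : ∀ t i r n → t + - (i + + 1) * n - r ≡ t - (i * n + (r + n))
          lem = solve-∀
        x<ρN : + 0 < + ρ + N - t x
        x<ρN = subst (+ 0 <_) (sym (trans (cong (λ e → + ρ + N - e) tx) (lem (t z) i′ (+ ρ) N))) (diff>0 t<)
          where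
          lem : ∀ t i r n → r + n - (t + - i * n) ≡ i * n + (r + n) - t
          lem = solve-∀
        x≥0 : + 0 ≤ t x
        x≥0 = ≤-by (≥0+≥0 x≥ρ (+≤+ {0} {ρ} ℕ.z≤n)) (lem (t x) (+ ρ))
          where
          lem : ∀ t r → t - + 0 ≡ (t - r) + r
          lem = solve-∀
        x<T : t x < T
        x<T = <-by (>0+≥0 x<ρN (+≤+ {0} {ρ} ℕ.z≤n)) (lem (t x) (+ ρ) N)
          where
          lem : ∀ t r n → r + r + n - t ≡ (r + n - t) + r
          lem = solve-∀
        moved : Fires 𝒰 (Infected u X′) z → Fires 𝒰 (Infected u s′) x
        moved fires = let U , U∈ , all = find fires in
          lose U∈ (All.tabulate λ {o} o∈ → Sum.map (subst (_< + 0) (yo o)) (λ q → inside o (∈-concat⁺′ o∈ U∈) q) (All.lookup all o∈))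
          where
          eq : ∀ o → shift i′ (x ⊕ o) ≡ z ⊕ o
          eq o = trans (sym (shift-⊕ i′ x o)) (cong (_⊕ o) (shift-inverse i′ z))
          yo : ∀ o → y (z ⊕ o) ≡ y (x ⊕ o)
          yo o = trans (cong y (sym (eq o))) (y-shift i′ (x ⊕ o))
          inside : ∀ o → o ∈ concat 𝒰 → z ⊕ o ∈ X′ → x ⊕ o ∈ s′
          inside o o∈ q = view⁻′ (∈-W⁺ ((subst (+ 0 ≤_) (yo o) (proj₁ (proj₁ (strip′ q))) , subst (_≤ + h) (yo o) (proj₂ (proj₁ (strip′ q))))
              , subst (+ 0 ≤_) (sym (⟪⟫-⊕ˡ x o p)) (≤-by (≥0+≥0 x≥ρ (diff≥0 (proj₁ (t-offset o∈)))) (lem₁ (t x) (t o) (+ ρ)))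
              , subst (_< T) (sym (⟪⟫-⊕ˡ x o p)) (<-by (>0+≥0 x<ρN (diff≥0 (proj₂ (t-offset o∈)))) (lem₂ (t x) (t o) (+ ρ) N))))
              (subst (_∈ X′) (sym (eq o)) q)
            where
            lem₁ : ∀ t o r → t + o - + 0 ≡ (t - r) + (o - - r)
            lem₁ = solve-∀
            lem₂ : ∀ t o r n → r + r + n - (t + o) ≡ (r + n - t) + (r - o)
            lem₂ = solve-∀
      inv′ : HalfClosed i′ s′ X′
      inv′ .view⁺ x∈ = ∈-++⁺ˡ (∈-map⁺ (shift i′) x∈)
      inv′ .view⁻ = view⁻′
      inv′ .strip = strip′
      inv′ .local = local′

    follow : ∀ {s w s′} → Path s w s′ → ∀ {i X} → HalfClosed i s X →
             ∃[ X′ ] (HalfClosed (end i w) s′ X′ × (∀ {z} → z ∈ X → z ∈ X′) × (∀ {z} → z ∈ placed i w → z ∈ X′))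
    follow [] {X = X} inv = X , inv , (λ z∈ → z∈) , λ ()
    follow (_∷_ {ℓ = ℓ} tr path) {i} inv =
      let X₁ , inv₁ , sub₁ , ℓ⊆ = step inv tr
          X₂ , inv₂ , sub₂ , w⊆ = follow path inv₁
      in X₂ , inv₂ , (λ z∈ → sub₂ (sub₁ z∈)) ,
         λ z∈ → Sum.[ (λ q → sub₂ (ℓ⊆ q)) , w⊆ ] (∈-++⁻ (map (shift (i + + 1)) ℓ) z∈)

    -- An empty last window leaves no point of `X` with `t ≥ i N`. Further right than `local`
    -- reaches, a rule can therefore use only the half-plane, and stability keeps its target there.
    finish : ∀ {i X} → HalfClosed i [] X → Closed 𝒰 (Infected u X)
    finish {i} {X} inv z fires with t z ℤₚ.<? i * N + (+ ρ + N)
    ... | yes lt = local inv z lt fires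
    ... | no ge = inj₁ (stable-below u stable (+ 0) z (fires-map-∈ (Infected u X) (InH u) z
            (λ o o∈ → Sum.[ (λ q → q) , (λ q → ⊥-elim (nothing-right o o∈ q)) ]) fires))
      where
      nothing-right : ∀ o → o ∈ concat 𝒰 → z ⊕ o ∉ X
      nothing-right o o∈ q = ∉[] (view⁻ inv {x} (∈-W⁺ ((subst (+ 0 ≤_) (sym yx) (proj₁ (proj₁ (strip inv q))) , subst (_≤ + h) (sym yx) (proj₂ (proj₁ (strip inv q))))
            , ≤-by (≥0+≥0 (≥0+≥0 (diff≥0 (ℤₚ.≮⇒≥ ge)) (diff≥0 (proj₁ (t-offset o∈)))) (ℤₚ.<⇒≤ N>0))
                (trans (cong (_- + 0) tx) (lem₁ (t z) (t o) i (+ ρ) N))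
            , <-by (diff>0 (proj₂ (strip inv q))) (trans (cong (λ e → T - e) (t-shift (- i) (z ⊕ o))) (lem₂ (t (z ⊕ o)) i N T))))
            (subst (_∈ X) (sym (shift-inverse i (z ⊕ o))) q))
        where
        x : Point
        x = shift (- i) (z ⊕ o)
        yx : y x ≡ y (z ⊕ o)
        yx = y-shift (- i) (z ⊕ o)
        tx : t x ≡ t z + t o + - i * N
        tx = trans (t-shift (- i) (z ⊕ o)) (cong (_+ - i * N) (⟪⟫-⊕ˡ z o p))
        lem₁ : ∀ t o i r n → t + o + - i * n - + 0 ≡ ((t - (i * n + (r + n))) + (o - - r)) + n
        lem₁ = solve-∀
        lem₂ : ∀ t i n T → T - (t + - i * n) ≡ i * n + T - t
        lem₂ = solve-∀

    closable : ∀ w i → Accept w → Closable 𝒰 u (placed i w)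
    closable w i (a , b , (n , pre) , path , (n′ , post)) =
      -- Starting `n` windows earlier makes the word itself begin at `i` after the leading blanks.
      let X₁ , inv₁ , _ , _ = follow pre (empty (i - + n))
          i≡ = trans (end-replicate n (i - + n)) (lem i (+ n))
          X₂ , inv₂ , _ , w⊆ = follow path (subst (λ j → HalfClosed j a X₁) i≡ inv₁)
          X₃ , inv₃ , sub , _ = follow post inv₂
      in X₃ , finish inv₃ , λ z∈ → sub (w⊆ z∈)
      where
      lem : ∀ i n → i - n + n ≡ i
      lem = solve-∀

-- Encoding point sets as words

module StripWords (𝒰 : UpdateFamily) (u : Direction) (h k : ℕ) where

  open Strip 𝒰 u h k

  -- `Z` is cut into slices of width `N`, one letter per slice; each point is read once, so the
  -- weight does not exceed the length.
  word : ∀ n i Z → length Z ℕ.≤ k →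
         (∀ {z} → z ∈ Z → (+ 0 ≤ y z × y z ≤ + h) × (i + + 1) * N ≤ t z × t z < (i + + 1 + + n) * N) →
         ∃[ w ] (All (_∈ listsUpTo k W) w × totalWeight w ℕ.≤ length Z × (∀ {z} → z ∈ Z → z ∈ placed i w))
  word zero i Z le bounds = [] , [] , ℕ.z≤n , λ {z} z∈ → let _ , lo , hi = bounds z∈ in
      ⊥-elim (ℤₚ.<⇒≱ hi (subst (λ e → e * N ≤ t z) (sym (ℤₚ.+-identityʳ (i + + 1))) lo))
  word (suc n) i Z le bounds =
    let w , w∈ , weight≤ , sub = word n (i + + 1) later (ℕₚ.≤-trans (Listₚ.length-filter (¬? ∘ now?) Z) le) bounds′
    in ℓ ∷ w , ∈-listsUpTo⁺ ℓ≤k ℓ⊆W ∷ w∈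
     , ℕₚ.≤-trans (ℕₚ.+-mono-≤ (ℕₚ.≤-reflexive (Listₚ.length-map (shift (- (i + + 1))) now)) weight≤) (ℕₚ.≤-reflexive (length-filter-split now? Z))
     , λ {z} z∈ → place z z∈ w sub
    where
    now? : ∀ z → Dec (t z < (i + + 1 + + 1) * N)
    now? z = t z ℤₚ.<? (i + + 1 + + 1) * N
    now later ℓ : List Point
    now = filter now? Z
    later = filter (¬? ∘ now?) Z
    ℓ = map (shift (- (i + + 1))) now
    ℓ≤k : length ℓ ℕ.≤ k
    ℓ≤k = ℕₚ.≤-trans (ℕₚ.≤-reflexive (Listₚ.length-map (shift (- (i + + 1))) now)) (ℕₚ.≤-trans (Listₚ.length-filter now? Z) le)
    inW : ∀ {z} → z ∈ now → InWindow (shift (- (i + + 1)) z)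
    inW {z} z∈ =
      let z∈Z , lt = ∈-filter⁻ now? {xs = Z} z∈
          (y≥0 , y≤h) , lo , _ = bounds z∈Z
      in (subst (+ 0 ≤_) (sym (y-shift (- (i + + 1)) z)) y≥0 , subst (_≤ + h) (sym (y-shift (- (i + + 1)) z)) y≤h)
       , ≤-by (diff≥0 lo) (trans (cong (_- + 0) (t-shift (- (i + + 1)) z)) (lem₁ (t z) (i + + 1) N))
       , <-by (>0+≥0 (diff>0 lt) (≥0+≥0 (+≤+ {0} {ρ} ℕ.z≤n) (+≤+ {0} {ρ} ℕ.z≤n)))
              (trans (cong (λ e → T - e) (t-shift (- (i + + 1)) z)) (lem₂ (t z) (i + + 1) N (+ ρ)))
      where
      lem₁ : ∀ t i n → t + - i * n - + 0 ≡ t - i * n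
      lem₁ = solve-∀
      lem₂ : ∀ t i n r → r + r + n - (t + - i * n) ≡ ((i + + 1) * n - t) + (r + r)
      lem₂ = solve-∀
    ℓ⊆W : All (_∈ W) ℓ
    ℓ⊆W = Allₚ.map⁺ (All.tabulate λ z∈ → ∈-W⁺ (inW z∈))
    bounds′ : ∀ {z} → z ∈ later → (+ 0 ≤ y z × y z ≤ + h) × (i + + 1 + + 1) * N ≤ t z × t z < (i + + 1 + + 1 + + n) * N
    bounds′ {z} z∈ =
      let z∈Z , nlt = ∈-filter⁻ (¬? ∘ now?) {xs = Z} z∈
          ys , _ , hi = bounds z∈Z
      in ys , ℤₚ.≮⇒≥ nlt , subst (λ e → t z < e * N) (sym (ℤₚ.+-assoc (i + + 1) (+ 1) (+ n))) hi
    place : ∀ z → z ∈ Z → ∀ w → (∀ {z} → z ∈ later → z ∈ placed (i + + 1) w) → z ∈ placed i (ℓ ∷ w)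
    place z z∈ w sub = go (now? z)
      where
      go : Dec (t z < (i + + 1 + + 1) * N) → z ∈ placed i (ℓ ∷ w)
      go (yes lt) = ∈-++⁺ˡ (subst (_∈ map (shift (i + + 1)) ℓ) (shift-inverse (i + + 1) z)
        (∈-map⁺ (shift (i + + 1)) {x = shift (- (i + + 1)) z} (∈-map⁺ (shift (- (i + + 1))) (∈-filter⁺ now? z∈ lt))))
      go (no nlt) = ∈-++⁺ʳ (map (shift (i + + 1)) ℓ) (sub (∈-filter⁺ (¬? ∘ now?) z∈ nlt))

  strip-word : ∀ Z → length Z ℕ.≤ k → (∀ {z} → z ∈ Z → + 0 ≤ y z × y z ≤ + h) →
               ∃[ i ] ∃[ w ] (All (_∈ listsUpTo k W) w × totalWeight w ℕ.≤ length Z × (∀ {z} → z ∈ Z → z ∈ placed i w))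
  -- The first slice starts at `- b N`, and the `2 b + 1` slices end at `(b + 1) N`, strictly beyond
  -- every `t z`.
  strip-word Z le strip = i , word (b ℕ.+ suc b) i Z le λ {z} z∈ →
      let lo , hi = abs-bounds (t z) (≤absBound t z∈) in strip z∈
    , ℤₚ.≤-trans (subst (λ j → j * N ≤ - (+ b)) (sym i+1) (i*N≤i (- (+ b)) (ℤₚ.neg-mono-≤ {+ 0} (+≤+ ℕ.z≤n)))) lo
    , ℤₚ.≤-<-trans hi (ℤₚ.<-≤-trans (+<+ {b} {suc b} ℕₚ.≤-refl)
        (subst (λ j → + suc b ≤ j * N) (sym (lem₂ (+ b))) (i≤i*N (+ suc b) (+≤+ ℕ.z≤n))))
    where
    b : ℕ
    b = absBound t Z
    i : ℤ
    i = - (+ b) - + 1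
    i+1 : i + + 1 ≡ - (+ b)
    i+1 = lem (+ b)
      where
      lem : ∀ b → - b - + 1 + + 1 ≡ - b
      lem = solve-∀
    lem₂ : ∀ b → - b - + 1 + + 1 + (b + (+ 1 + b)) ≡ + 1 + b
    lem₂ = solve-∀

  strip-closable : Stable 𝒰 u → ¬ Rejected k → ∀ Z → length Z ℕ.≤ k → (∀ {z} → z ∈ Z → + 0 ≤ y z × y z ≤ + h) → Closable 𝒰 u Z
  strip-closable stable none Z le strip =
    let i , w , w∈ , weight≤ , sub = strip-word Z le strip
        X , closed , ⊆X = FromAccept.closable stable w i
          (decidable-stable (Accept? w) λ rej → none (w , w∈ , ℕₚ.≤-trans weight≤ le , rej))
    in X , closed , λ z∈ → ⊆X (sub z∈)

  rejected⇒infinite : Rejected k → ∃[ Z ] (length Z ℕ.≤ k × All (λ z → ¬ InH u z) Z × InfiniteSet (ZBar 𝒰 u Z))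
  rejected⇒infinite (w , w∈ , weight≤ , rej) =
    placed (+ 0) w , ℕₚ.≤-trans (ℕₚ.≤-reflexive (length-placed w (+ 0))) weight≤ , placed-notH w (+ 0) w∈ ,
    λ finite → let X , closed , sub = finite⇒closable {𝒰} {u} {placed (+ 0) w} (placed-notH w (+ 0) w∈) finite
               in rej (FromClosed.accepted X closed w w∈ sub)

-- Reduction to bounded height

-- The part of Z above a sufficiently large gap in the heights cannot interact with the rest.
module HeightReduction (𝒰 : UpdateFamily) (S : List Direction) (u : Direction) (k : ℕ) where

  open Droplets 𝒰 S using (spread)

  y : Point → ℤ
  y x = ⟪ x , vec u ⟫

  -- `drop` bounds how far the cover of a point hangs below it. Beyond that, `gap` leaves more than
  -- `ρ + ρ`, the largest height difference within one rule.
  m ρ drop gap height : ℕ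
  m = coordBound (vec u ∷ [])
  ρ = absBound y (concat 𝒰)
  drop = spread k ℕ.* m ℕ.+ spread k ℕ.* m
  gap = suc (drop ℕ.+ (ρ ℕ.+ ρ))
  height = k ℕ.* gap

  -- Pigeonhole over slabs of thickness `gap`: every occupied slab uses up a point, so at most `n`
  -- of them precede an empty one.
  find-gap : ∀ Z n j → length (filter (λ z → + (j ℕ.* gap) ℤₚ.≤? y z) Z) ℕ.≤ n →
             ∃[ a ] (a ℕ.≤ (j ℕ.+ n) ℕ.* gap × (∀ {z} → z ∈ Z → ¬ y z < + a → + (gap ℕ.+ a) ≤ y z))
  find-gap Z n j le with any? (λ z → (+ (j ℕ.* gap) ℤₚ.≤? y z) ×-dec (y z ℤₚ.<? + (gap ℕ.+ j ℕ.* gap))) Z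
  ... | no none = j ℕ.* gap , ℕₚ.*-monoˡ-≤ gap (ℕₚ.m≤m+n j n) , λ z∈ nlt → ℤₚ.≮⇒≥ λ lt → none (lose z∈ (ℤₚ.≮⇒≥ nlt , lt))
  ... | yes some with find some
  ... | z , z∈ , lo , hi with ℕₚ.<-≤-trans (length-filter-mono-< (λ z → + (suc j ℕ.* gap) ℤₚ.≤? y z) (λ z → + (j ℕ.* gap) ℤₚ.≤? y z)
          (λ _ q → ℤₚ.≤-trans (+≤+ (ℕₚ.m≤n+m (j ℕ.* gap) gap)) q) z∈ (λ q → ℤₚ.<⇒≱ hi q) lo) le
  find-gap Z (suc n) j le | yes some | z , z∈ , lo , hi | ℕ.s≤s lt with find-gap Z n (suc j) lt
  ... | a , a≤ , sep = a , subst (λ i → a ℕ.≤ i ℕ.* gap) (sym (ℕₚ.+-suc j n)) a≤ , sep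

  module _ (S-stable : All (Stable 𝒰) S) (meets : ∀ v → v ≢ origin → ∃[ s ] (s ∈ S × + 0 < ⟪ vec s , v ⟫))
           (stable : Stable 𝒰 u)
           (low-closable : ∀ Z → length Z ℕ.≤ k → (∀ {z} → z ∈ Z → + 0 ≤ y z × y z ≤ + height) → Closable 𝒰 u Z) where

    -- `X` may stick out above height `a`; cutting it there keeps it closed together with the
    -- half-plane, because the heights below `a` form a closed set. `Y` is closed by itself, and no
    -- rule reaches both parts.
    all-closable : ∀ Z → length Z ℕ.≤ k → All (λ z → ¬ InH u z) Z → Closable 𝒰 u Z
    all-closable Z le notH with find-gap Z k 0 (ℕₚ.≤-trans (Listₚ.length-filter (λ z → + 0 ℤₚ.≤? y z) Z) le)
    ... | a , a≤ , sep = X′ ++ Y , closed , covers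
      where
      low? : ∀ z → Dec (y z < + a)
      low? z = y z ℤₚ.<? + a
      lowPart highPart : List Point
      lowPart = filter low? Z
      highPart = filter (¬? ∘ low?) Z
      lowClosure : Closable 𝒰 u lowPart
      lowClosure = low-closable lowPart (ℕₚ.≤-trans (Listₚ.length-filter low? Z) le) λ z∈ →
        let z∈Z , lt = ∈-filter⁻ low? {xs = Z} z∈ in
        ℤₚ.≮⇒≥ (All.lookup notH z∈Z) , ℤₚ.≤-trans (ℤₚ.<⇒≤ lt) (+≤+ a≤)
      X X′ Y : List Point
      X = proj₁ lowClosure
      X′ = filter low? X
      X-closed : Closed 𝒰 (Infected u X)
      X-closed = proj₁ (proj₂ lowClosure)
      highCover : ∃[ Y ] (Closed 𝒰 (_∈ Y) × (∀ {z} → z ∈ highPart → z ∈ Y) ×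
                          (∀ {y} → y ∈ Y → ∃[ z ] (z ∈ highPart × CoordsWithin (spread k) (y ⊖ z))))
      highCover = Droplets.cover 𝒰 S S-stable meets k highPart (ℕₚ.≤-trans (Listₚ.length-filter (¬? ∘ low?) Z) le)
      Y = proj₁ highCover
      Y-closed : Closed 𝒰 (_∈ Y)
      Y-closed = proj₁ (proj₂ highCover)
      Y-high : ∀ {x} → x ∈ Y → + a + + (ρ ℕ.+ ρ) < y x
      Y-high {x} x∈ =
        let z , z∈ , near = proj₂ (proj₂ (proj₂ highCover)) x∈
            z∈Z , nlt = ∈-filter⁻ (¬? ∘ low?) {xs = Z} z∈
            lo , _ = abs-bounds (y (x ⊖ z)) (abs-⟪⟫-≤ (x ⊖ z) (vec u) near (∈⇒coordsWithin {xs = vec u ∷ []} (here refl)))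
        in <-by (>0+≥0 (+<+ {0} {1} (ℕ.s≤s ℕ.z≤n)) (≥0+≥0 (diff≥0 (subst (- (+ drop) ≤_) (⟪⟫-⊖ˡ x z (vec u)) lo)) (diff≥0 (sep z∈Z nlt))))
             (lem (y x) (y z) (+ a) (+ drop) (+ (ρ ℕ.+ ρ)))
        where
        lem : ∀ x z a d r → x - (a + r) ≡ + 1 + ((x - z - - d) + (z - ((+ 1 + (d + r)) + a)))
        lem = solve-∀
      infected-low : ∀ {x} → Infected u X′ x → y x < + a
      infected-low (inj₁ q) = ℤₚ.<-≤-trans q (+≤+ ℕ.z≤n)
      infected-low (inj₂ q) = proj₂ (∈-filter⁻ low? {xs = X} q)
      X′⊆X : ∀ {x} → Infected u X′ x → Infected u X x
      X′⊆X = Sum.map₂ λ q → proj₁ (∈-filter⁻ low? {xs = X} q)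
      split : ∀ {x} → Infected u (X′ ++ Y) x → Infected u X′ x ⊎ x ∈ Y
      split (inj₁ q) = inj₁ (inj₁ q)
      split (inj₂ q) = Sum.map₁ inj₂ (∈-++⁻ X′ q)
      covers : ∀ {z} → z ∈ Z → z ∈ X′ ++ Y
      covers {z} z∈ with low? z
      ... | yes lt = ∈-++⁺ˡ (∈-filter⁺ low? (proj₂ (proj₂ lowClosure) (∈-filter⁺ low? z∈ lt)) lt)
      ... | no nlt = ∈-++⁺ʳ X′ (proj₁ (proj₂ (proj₂ highCover)) (∈-filter⁺ (¬? ∘ low?) z∈ nlt))
      closed : Closed 𝒰 (Infected u (X′ ++ Y))
      closed x fires = let U , U∈ , all = find fires in go U U∈ all (any? (λ o → x ⊕ o ∈? Y) U)
        where
        go : ∀ U → U ∈ 𝒰 → All (λ o → Infected u (X′ ++ Y) (x ⊕ o)) U → Dec (Any (λ o → x ⊕ o ∈ Y) U) → Infected u (X′ ++ Y) x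
        go U U∈ all (no none) = Sum.map₂ (λ q → ∈-++⁺ˡ (∈-filter⁺ low? q x-low)) (X-closed x (lose U∈ (All.map X′⊆X inX′)))
          where
          inX′ : All (λ o → Infected u X′ (x ⊕ o)) U
          inX′ = All.tabulate λ o∈ → Sum.[ (λ q → q) , (λ q → ⊥-elim (none (lose o∈ q))) ] (split (All.lookup all o∈))
          x-low : y x < + a
          x-low = stable-below u stable (+ a) x (lose U∈ (All.map infected-low inX′))
        go U U∈ all (yes some) = inj₂ (∈-++⁺ʳ X′ (Y-closed x (lose U∈ (All.tabulate λ {o} o∈ →
            Sum.[ (λ q → ⊥-elim (too-close o o∈ (infected-low q))) , (λ q → q) ] (split (All.lookup all o∈))))))
          where
          o₁ : Point
          o₁ = proj₁ (find some)
          offset : ∀ {o} → o ∈ U → - (+ ρ) ≤ y o × y o ≤ + ρ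
          offset {o} o∈ = abs-bounds (y o) (≤absBound y (∈-concat⁺′ o∈ U∈))
          too-close : ∀ o → o ∈ U → ¬ y (x ⊕ o) < + a
          too-close o o∈ lt = ℤₚ.<-irrefl refl (subst (+ 0 <_) (lem (y x) (y o) (y o₁) (+ a) (+ ρ))
            (>0+≥0 (>0+≥0 (>0+>0 (diff>0 (subst (_< + a) (⟪⟫-⊕ˡ x o (vec u)) lt))
                     (diff>0 (subst (+ a + + (ρ ℕ.+ ρ) <_) (⟪⟫-⊕ˡ x o₁ (vec u)) (Y-high (proj₂ (proj₂ (find some)))))))
              (diff≥0 (proj₁ (offset o∈)))) (diff≥0 (proj₂ (offset (proj₁ (proj₂ (find some))))))))
            where
            lem : ∀ x o o₁ a r → (((a - (x + o)) + (x + o₁ - (a + (r + r)))) + (o - - r)) + (r - o₁) ≡ + 0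
            lem = solve-∀

-- Slight rotations and isolated directions

-- A rule lying in the open half-plane of every direction slightly rotated from u towards q.
Side : UpdateFamily → Point → Point → Set
Side 𝒰 u q = Any (All (λ x → ⟪ x , u ⟫ < + 0 ⊎ (⟪ x , u ⟫ ≡ + 0 × ⟪ x , q ⟫ < + 0))) 𝒰

side? : ∀ 𝒰 u q → Dec (Side 𝒰 u q)
side? 𝒰 u q = any? (All.all? (λ x → (⟪ x , u ⟫ ℤₚ.<? + 0) ⊎-dec ((⟪ x , u ⟫ ℤₚ.≟ + 0) ×-dec (⟪ x , q ⟫ ℤₚ.<? + 0)))) 𝒰

TwoSided : UpdateFamily → Direction → Set
TwoSided 𝒰 u = Side 𝒰 (vec u) (perp (vec u)) × Side 𝒰 (vec u) (neg (perp (vec u)))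

twoSided? : ∀ 𝒰 u → Dec (TwoSided 𝒰 u)
twoSided? 𝒰 u = side? 𝒰 (vec u) (perp (vec u)) ×-dec side? 𝒰 (vec u) (neg (perp (vec u)))

-- Products are integers: `⟪ x , u ⟫ < 0` contributes at most `- a`, which outweighs the part along
-- `q` since `a > b n`. If `⟪ x , u ⟫` is 0, the part along `q` decides.
side⇒unstable : ∀ {𝒰} u q w n {c} a b → + 0 < c → (∀ x → c * ⟪ x , w ⟫ ≡ a * ⟪ x , u ⟫ + b * ⟪ x , q ⟫) →
                + 0 < b → + 0 ≤ n → + 0 < a - b * n → (∀ {x} → x ∈ concat 𝒰 → ⟪ x , q ⟫ ≤ n) → Side 𝒰 u q → Any (All (λ x → ⟪ x , w ⟫ < + 0)) 𝒰
side⇒unstable {𝒰} u q w n {c} a b c>0 eq b>0 n≥0 narrow bound side =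
  let U , U∈ , all = find side in lose U∈ (All.tabulate λ {x} x∈ → negative x (∈-concat⁺′ x∈ U∈) (All.lookup all x∈))
  where
  a≥0 : + 0 ≤ a
  a≥0 = subst (+ 0 ≤_) (lem a (b * n)) (≥0+≥0 (ℤₚ.<⇒≤ narrow) (≥0*≥0 (ℤₚ.<⇒≤ b>0) n≥0))
    where
    lem : ∀ a e → a - e + e ≡ a
    lem = solve-∀
  negative : ∀ x → x ∈ concat 𝒰 → ⟪ x , u ⟫ < + 0 ⊎ (⟪ x , u ⟫ ≡ + 0 × ⟪ x , q ⟫ < + 0) → ⟪ x , w ⟫ < + 0
  negative x x∈ (inj₁ s<0) = cancel-<0 c>0 (subst (_< + 0) (sym (eq x))
    (<-by (≥0+>0 (≥0*≥0 a≥0 (diff≥0 (ℤₚ.i<j⇒suc[i]≤j s<0))) (>0+≥0 narrow (≥0*≥0 (ℤₚ.<⇒≤ b>0) (diff≥0 (bound x∈)))))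
      (lem a b ⟪ x , u ⟫ ⟪ x , q ⟫ n)))
    where
    lem : ∀ a b s r n → + 0 - (a * s + b * r) ≡ a * (+ 0 - (+ 1 + s)) + ((a - b * n) + b * (n - r))
    lem = solve-∀
  negative x x∈ (inj₂ (s≡0 , r<0)) = cancel-<0 c>0 (subst (_< + 0) (sym (trans (eq x) (cong (λ s → a * s + b * ⟪ x , q ⟫) s≡0)))
    (<-by (>0*>0 b>0 (<0⇒->0 r<0)) (lem a b ⟪ x , q ⟫)))
    where
    lem : ∀ a b r → + 0 - (a * + 0 + b * r) ≡ b * - r
    lem = solve-∀

⟪u,perp⟫ : ∀ u → ⟪ u , perp u ⟫ ≡ + 0
⟪u,perp⟫ u = trans (⟪⟫-comm u (perp u)) (perp-orth u)

rotated : ∀ n u q → ⟪ q , perp u ⟫ ≢ + 0 → Direction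
rotated n u q q≢0 = ((n ⊗ u) ⊕ q) , λ e → q≢0 (trans (sym lem) (trans (cong (λ z → ⟪ z , perp u ⟫) e) (⟪origin⟫ (perp u))))
  where
  lem : ⟪ (n ⊗ u) ⊕ q , perp u ⟫ ≡ ⟪ q , perp u ⟫
  lem = trans (⟪⟫-⊕ˡ (n ⊗ u) q (perp u)) (trans (cong (_+ ⟪ q , perp u ⟫) (trans (⟪⟫-⊗ˡ n u (perp u)) (trans (cong (n *_) (⟪u,perp⟫ u)) (ℤₚ.*-zeroʳ n)))) (ℤₚ.+-identityˡ ⟪ q , perp u ⟫))

cross-rotatedˡ : ∀ n u q x → cross ((n ⊗ u) ⊕ q) x ≡ n * cross u x + cross q x
cross-rotatedˡ n (a , b) (c , d) (e , f) = lem n a b c d e f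
  where
  lem : ∀ n a b c d e f → (n * a + c) * f - (n * b + d) * e ≡ n * (a * f - b * e) + (c * f - d * e)
  lem = solve-∀

cross-rotatedʳ : ∀ n u q x → cross x ((n ⊗ u) ⊕ q) ≡ n * cross x u + cross x q
cross-rotatedʳ n (a , b) (c , d) (e , f) = lem n a b c d e f
  where
  lem : ∀ n a b c d e f → e * (n * b + d) - f * (n * a + c) ≡ n * (e * b - f * a) + (e * d - f * c)
  lem = solve-∀

dominates : ∀ n c r → + 0 < c → ∣ r ∣ ℕ.< n → + 0 < + n * c + r
dominates n c r c>0 r<n = <-by
  (>0+≥0 (diff>0 (+<+ r<n))
    (≥0+≥0 (≥0*≥0 (+≤+ {0} {n} ℕ.z≤n) (diff≥0 (ℤₚ.i<j⇒suc[i]≤j c>0))) (diff≥0 (proj₁ (abs-bounds r ℕₚ.≤-refl)))))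
  (lem (+ n) c r (+ ∣ r ∣))
  where
  lem : ∀ n c r a → n * c + r - + 0 ≡ (n - a) + (n * (c - (+ 0 + + 1)) + (r - - a))
  lem = solve-∀

-- For such large `n`, the sign of `n ⟪ x , u ⟫ + ⟪ x , q ⟫` is determined lexicographically, as in
-- `Side`.
unstable⇒side : ∀ {𝒰} n u q → (∀ {x} → x ∈ concat 𝒰 → ∣ ⟪ x , q ⟫ ∣ ℕ.< n) →
                Any (All (λ x → ⟪ x , (+ n ⊗ u) ⊕ q ⟫ < + 0)) 𝒰 → Side 𝒰 u q
unstable⇒side n u q bound unst =
  let U , U∈ , all = find unst in lose U∈ (All.tabulate λ {x} x∈ → sign x (bound (∈-concat⁺′ x∈ U∈)) (subst (_< + 0) (eq x) (All.lookup all x∈)))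
  where
  eq : ∀ x → ⟪ x , (+ n ⊗ u) ⊕ q ⟫ ≡ + n * ⟪ x , u ⟫ + ⟪ x , q ⟫
  eq x = trans (⟪⟫-⊕ʳ x (+ n ⊗ u) q) (cong (_+ ⟪ x , q ⟫) (⟪⟫-⊗ʳ (+ n) x u))
  sign : ∀ x → ∣ ⟪ x , q ⟫ ∣ ℕ.< n → + n * ⟪ x , u ⟫ + ⟪ x , q ⟫ < + 0 → ⟪ x , u ⟫ < + 0 ⊎ (⟪ x , u ⟫ ≡ + 0 × ⟪ x , q ⟫ < + 0)
  sign x small neg with ℤₚ.<-cmp ⟪ x , u ⟫ (+ 0)
  ... | tri< s<0 _ _ = inj₁ s<0
  ... | tri≈ _ s≡0 _ = inj₂ (s≡0 , subst (_< + 0) (trans (cong (λ s → + n * s + ⟪ x , q ⟫) s≡0) (trans (cong (_+ ⟪ x , q ⟫) (ℤₚ.*-zeroʳ (+ n))) (ℤₚ.+-identityˡ ⟪ x , q ⟫))) neg)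
  ... | tri> _ _ s>0 = ⊥-elim (ℤₚ.<-asym neg (dominates n ⟪ x , u ⟫ ⟪ x , q ⟫ s>0 small))

perp-side : ∀ u → u ≢ origin → ⟪ perp u , perp u ⟫ ≢ + 0
perp-side u u≢0 e = ℤₚ.<-irrefl (sym e) (norm>0 (perp u) (perp≢0 u≢0))

neg-perp-side : ∀ u → u ≢ origin → ⟪ neg (perp u) , perp u ⟫ ≢ + 0
neg-perp-side u u≢0 e = perp-side u u≢0 (trans (sym (ℤₚ.neg-involutive ⟪ perp u , perp u ⟫)) (cong -_ (trans (sym (⟪⟫-negˡ (perp u) (perp u))) e)))

-- Between `n u - perp u` and `n u + perp u`, the two cross product conditions are the narrowness
-- hypotheses of `side⇒unstable` for the two signs of `⟪ w , perp u ⟫`.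
twoSided⇒isolated : ∀ {𝒰} u → Stable 𝒰 u → TwoSided 𝒰 u → IsolatedStable 𝒰 u
twoSided⇒isolated {𝒰} u stable (left , right) =
  stable , rotated (+ n) U (neg p) (neg-perp-side U (proj₂ u)) , rotated (+ n) U p (perp-side U (proj₂ u)) ,
  subst (+ 0 <_) (sym (lem₁ (+ n) (proj₁ U) (proj₂ U))) pp>0 , subst (+ 0 <_) (sym (lem₂ (+ n) (proj₁ U) (proj₂ U))) pp>0 ,
  λ w c₁ c₂ notSame → unstable w (subst (+ 0 <_) (lem₃ (+ n) (proj₁ U) (proj₂ U) (proj₁ (vec w)) (proj₂ (vec w))) c₁)
                                 (subst (+ 0 <_) (lem₄ (+ n) (proj₁ U) (proj₂ U) (proj₁ (vec w)) (proj₂ (vec w))) c₂) notSame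
  where
  U p : Point
  U = vec u
  p = perp U
  n : ℕ
  n = absBound (λ x → ⟪ x , p ⟫) (concat 𝒰)
  pp>0 : + 0 < ⟪ U , U ⟫
  pp>0 = norm>0 U (proj₂ u)
  lem₁ : ∀ n a b → (n * a + - - b) * b - (n * b + - a) * a ≡ a * a + b * b
  lem₁ = solve-∀
  lem₂ : ∀ n a b → a * (n * b + a) - b * (n * a + - b) ≡ a * a + b * b
  lem₂ = solve-∀
  lem₃ : ∀ n a b c d → (n * a + - - b) * d - (n * b + - a) * c ≡ (c * a + d * b) - - (c * - b + d * a) * n
  lem₃ = solve-∀
  lem₄ : ∀ n a b c d → c * (n * b + a) - d * (n * a + - b) ≡ (c * a + d * b) - (c * - b + d * a) * n
  lem₄ = solve-∀
  unstable : ∀ w → + 0 < ⟪ vec w , U ⟫ - - ⟪ vec w , p ⟫ * + n → + 0 < ⟪ vec w , U ⟫ - ⟪ vec w , p ⟫ * + n → ¬ SameDir w u → Unstable 𝒰 w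
  unstable w h₁ h₂ notSame with ℤₚ.<-cmp (+ 0) ⟪ vec w , p ⟫
  ... | tri< b>0 _ _ = side⇒unstable U p (vec w) (+ n) ⟪ vec w , U ⟫ ⟪ vec w , p ⟫ pp>0 (λ x → decompose U x (vec w)) b>0 (+≤+ ℕ.z≤n) h₂
          (λ {x} x∈ → proj₂ (abs-bounds ⟪ x , p ⟫ (≤absBound (λ x → ⟪ x , p ⟫) x∈))) left
  ... | tri> _ _ b<0 = side⇒unstable U (neg p) (vec w) (+ n) ⟪ vec w , U ⟫ (- ⟪ vec w , p ⟫) pp>0
          (λ x → trans (decompose U x (vec w)) (trans (lem ⟪ vec w , U ⟫ ⟪ x , U ⟫ ⟪ vec w , p ⟫ ⟪ x , p ⟫)
            (cong (λ e → ⟪ vec w , U ⟫ * ⟪ x , U ⟫ + - ⟪ vec w , p ⟫ * e) (sym (⟪⟫-negʳ x p))))) (<0⇒->0 b<0) (+≤+ ℕ.z≤n) h₁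
          (λ {x} x∈ → subst₂ _≤_ (sym (⟪⟫-negʳ x p)) (ℤₚ.neg-involutive (+ n)) (ℤₚ.neg-mono-≤ (proj₁ (abs-bounds ⟪ x , p ⟫ (≤absBound (λ x → ⟪ x , p ⟫) x∈))))) right
    where
    lem : ∀ a s b r → a * s + b * r ≡ a * s + - b * - r
    lem = solve-∀
  ... | tri≈ _ b≡0 _ = ⊥-elim (notSame (trans (cross-⟪⟫′ (vec w) U) (cong -_ (sym b≡0))
          , subst (+ 0 <_) (trans (cong (λ b → ⟪ vec w , U ⟫ - b * + n) (sym b≡0)) (ℤₚ.+-identityʳ ⟪ vec w , U ⟫)) h₂))

-- For `n` beyond the cross products of `q` with both ends, `n u + q` lies in the neighbourhood but
-- not on the ray of `u`, so it is unstable.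
isolated⇒twoSided : ∀ {𝒰} u → IsolatedStable 𝒰 u → TwoSided 𝒰 u
isolated⇒twoSided {𝒰} u (stable , v₁ , v₂ , h₁ , h₂ , near) =
  side p (perp-side U (proj₂ u)) , side (neg p) (neg-perp-side U (proj₂ u))
  where
  U p : Point
  U = vec u
  p = perp U
  side : ∀ q → ⟪ q , p ⟫ ≢ + 0 → Side 𝒰 U q
  side q q≢0 = unstable⇒side n U q (λ x∈ → ℕ.s≤s (ℕₚ.≤-trans (≤absBound (λ x → ⟪ x , q ⟫) x∈) (ℕₚ.m≤m+n b _)))
    (near (rotated (+ n) U q q≢0)
      (subst (+ 0 <_) (sym (cross-rotatedʳ (+ n) U q (vec v₁))) (dominates n (cross (vec v₁) U) r₁ h₁ (ℕ.s≤s (ℕₚ.≤-trans (ℕₚ.m≤m+n ∣ r₁ ∣ ∣ r₂ ∣) (ℕₚ.m≤n+m (∣ r₁ ∣ ℕ.+ ∣ r₂ ∣) b)))))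
      (subst (+ 0 <_) (sym (cross-rotatedˡ (+ n) U q (vec v₂))) (dominates n (cross U (vec v₂)) r₂ h₂ (ℕ.s≤s (ℕₚ.≤-trans (ℕₚ.m≤n+m ∣ r₂ ∣ ∣ r₁ ∣) (ℕₚ.m≤n+m (∣ r₁ ∣ ℕ.+ ∣ r₂ ∣) b)))))
      λ (c≡0 , _) → q≢0 (trans (sym (ℤₚ.neg-involutive ⟪ q , p ⟫)) (cong -_ (trans (sym crossq) c≡0))))
    where
    r₁ r₂ : ℤ
    r₁ = cross (vec v₁) q
    r₂ = cross q (vec v₂)
    b n : ℕ
    b = absBound (λ x → ⟪ x , q ⟫) (concat 𝒰)
    n = suc (b ℕ.+ (∣ r₁ ∣ ℕ.+ ∣ r₂ ∣))
    crossq : cross ((+ n ⊗ U) ⊕ q) U ≡ - ⟪ q , p ⟫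
    crossq = trans (cross-rotatedˡ (+ n) U q U) (trans (cong₂ (λ a b → + n * a + b) (trans (cross-⟪⟫ U U) (⟪u,perp⟫ U)) (cross-⟪⟫′ q U))
      (trans (cong (_+ - ⟪ q , p ⟫) (ℤₚ.*-zeroʳ (+ n))) (ℤₚ.+-identityˡ (- ⟪ q , p ⟫))))

cross-perp : ∀ u x → cross (perp u) x ≡ - ⟪ x , u ⟫
cross-perp (a , b) (c , d) = lem a b c d
  where
  lem : ∀ a b c d → - b * d - a * c ≡ - (c * a + d * b)
  lem = solve-∀

cross-neg-perp : ∀ u x → cross (neg (perp u)) x ≡ ⟪ x , u ⟫
cross-neg-perp (a , b) (c , d) = lem a b c d
  where
  lem : ∀ a b c d → - - b * d - - a * c ≡ c * a + d * b
  lem = solve-∀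

-- The directions n u ± perp u are distinct from the finitely many stable ones for large n.
finitely-stable⇒twoSided : ∀ {𝒰} v L → (∀ u → InSemicircle v u → Stable 𝒰 u → Any (λ w → SameDir u w) L) →
                           ∀ u → InSemicircle v u → TwoSided 𝒰 u
finitely-stable⇒twoSided {𝒰} v L fin u u∈ =
    side p (perp-side U (proj₂ u)) (λ x e → trans (sym (ℤₚ.neg-involutive ⟪ x , U ⟫)) (cong -_ (trans (sym (cross-perp U x)) e)))
  , side (neg p) (neg-perp-side U (proj₂ u)) (λ x e → trans (sym (cross-neg-perp U x)) e)
  where
  U p : Point
  U = vec u
  p = perp U
  side : ∀ q → ⟪ q , p ⟫ ≢ + 0 → (∀ x → cross q x ≡ + 0 → ⟪ x , U ⟫ ≡ + 0) → Side 𝒰 U q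
  side q q≢0 q-cross = unstable⇒side n U q (λ x∈ → ℕ.s≤s (ℕₚ.≤-trans (≤absBound (λ x → ⟪ x , q ⟫) x∈) (ℕₚ.m≤m+n b _)))
    (decidable-stable (unstable? 𝒰 w) λ st → let l , l∈ , same , _ = find (fin w w∈ st) in notSame l l∈ same)
    where
    b c n : ℕ
    b = absBound (λ x → ⟪ x , q ⟫) (concat 𝒰)
    c = absBound (λ l → cross q (vec l)) L
    n = suc (b ℕ.+ (∣ ⟪ q , vec v ⟫ ∣ ℕ.+ c))
    w : Direction
    w = rotated (+ n) U q q≢0
    w∈ : InSemicircle v w
    w∈ = subst (+ 0 <_) (sym (trans (⟪⟫-⊕ˡ (+ n ⊗ U) q (vec v)) (cong (_+ ⟪ q , vec v ⟫) (⟪⟫-⊗ˡ (+ n) U (vec v)))))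
      (dominates n ⟪ U , vec v ⟫ ⟪ q , vec v ⟫ u∈ (ℕ.s≤s (ℕₚ.≤-trans (ℕₚ.m≤m+n ∣ ⟪ q , vec v ⟫ ∣ c) (ℕₚ.m≤n+m (∣ ⟪ q , vec v ⟫ ∣ ℕ.+ c) b))))
    notSame : ∀ l → l ∈ L → cross (vec w) (vec l) ≢ + 0
    notSame l l∈ same = go (ℤₚ.<-cmp (+ 0) (cross U (vec l)))
      where
      eq : + n * cross U (vec l) + cross q (vec l) ≡ + 0
      eq = trans (sym (cross-rotatedˡ (+ n) U q (vec l))) same
      small : ∣ cross q (vec l) ∣ ℕ.< n
      small = ℕ.s≤s (ℕₚ.≤-trans (≤absBound (λ l → cross q (vec l)) l∈) (ℕₚ.≤-trans (ℕₚ.m≤n+m c ∣ ⟪ q , vec v ⟫ ∣) (ℕₚ.m≤n+m (∣ ⟪ q , vec v ⟫ ∣ ℕ.+ c) b)))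
      go : Tri (+ 0 < cross U (vec l)) (+ 0 ≡ cross U (vec l)) (cross U (vec l) < + 0) → ⊥
      go (tri< c>0 _ _) = ℤₚ.<-irrefl (sym eq) (dominates n (cross U (vec l)) (cross q (vec l)) c>0 small)
      go (tri> _ _ c<0) = ℤₚ.<-irrefl refl (subst (+ 0 <_) (trans (lem (+ n) (cross U (vec l)) (cross q (vec l))) (cong -_ eq))
          (dominates n (- cross U (vec l)) (- cross q (vec l)) (<0⇒->0 c<0) (subst (ℕ._< n) (sym (ℤₚ.∣-i∣≡∣i∣ (cross q (vec l)))) small)))
        where
        lem : ∀ n c r → n * - c + - r ≡ - (n * c + r)
        lem = solve-∀
      -- `l` would be parallel to `U` and to `q`, which are orthogonal, and so vanish.
      go (tri≈ _ c≡0 _) = ℤₚ.<-irrefl (sym norms≡0) (>0*>0 (norm>0 U (proj₂ u)) (norm>0 (vec l) (proj₂ l)))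
        where
        r≡0 : cross q (vec l) ≡ + 0
        r≡0 = trans (sym (trans (cong (λ c → + n * c + cross q (vec l)) (sym c≡0)) (trans (cong (_+ cross q (vec l)) (ℤₚ.*-zeroʳ (+ n))) (ℤₚ.+-identityˡ (cross q (vec l)))))) eq
        norms≡0 : ⟪ U , U ⟫ * ⟪ vec l , vec l ⟫ ≡ + 0
        norms≡0 = trans (decompose U (vec l) (vec l)) (cong₂ (λ a b → a * a + b * b) (q-cross (vec l) r≡0) (trans (sym (cross-⟪⟫ U (vec l))) (sym c≡0)))

-- Invariance under the choice of a vector on the ray

module Proportional (c w : Direction) (same : SameDir c w) where

  κ λ′ : ℤ
  κ = ⟪ vec c , vec c ⟫
  λ′ = ⟪ vec w , vec c ⟫

  κ>0 : + 0 < κ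
  κ>0 = norm>0 (vec c) (proj₂ c)

  λ>0 : + 0 < λ′
  λ>0 = subst (+ 0 <_) (⟪⟫-comm (vec c) (vec w)) (proj₂ same)

  scale : ∀ x → κ * ⟪ x , vec w ⟫ ≡ λ′ * ⟪ x , vec c ⟫
  scale x = trans (decompose (vec c) x (vec w))
    (trans (cong (λ b → λ′ * ⟪ x , vec c ⟫ + b * ⟪ x , perp (vec c) ⟫) (trans (sym (cross-⟪⟫ (vec c) (vec w))) (proj₁ same))) (ℤₚ.+-identityʳ (λ′ * ⟪ x , vec c ⟫)))

  inH⁺ : ∀ x → InH c x → InH w x
  inH⁺ x q = cancel-<0 κ>0 (subst (_< + 0) (sym (scale x)) (pos*neg λ>0 q))

  inH⁻ : ∀ x → InH w x → InH c x
  inH⁻ x q = cancel-<0 λ>0 (subst (_< + 0) (scale x) (pos*neg κ>0 q))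

  pos⁺ : ∀ x → + 0 < ⟪ x , vec c ⟫ → + 0 < ⟪ x , vec w ⟫
  pos⁺ x q = cancel->0 κ>0 (subst (+ 0 <_) (sym (scale x)) (>0*>0 λ>0 q))

  zero⁺ : ∀ x → ⟪ x , vec c ⟫ ≡ + 0 → ⟪ x , vec w ⟫ ≡ + 0
  zero⁺ x q = cancel-≡0 κ>0 (trans (scale x) (trans (cong (λ′ *_) q) (ℤₚ.*-zeroʳ λ′)))

  cross-as-⟪⟫ : ∀ x z → cross x z ≡ ⟪ perp x , z ⟫
  cross-as-⟪⟫ x z = trans (cross-⟪⟫ x z) (⟪⟫-comm z (perp x))

  cross-as-⟪⟫′ : ∀ x z → cross x z ≡ ⟪ neg (perp z) , x ⟫
  cross-as-⟪⟫′ x z = trans (cross-⟪⟫′ x z) (trans (cong -_ (⟪⟫-comm x (perp z))) (sym (⟪⟫-negˡ (perp z) x)))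

  sameDir⁺ : ∀ v → SameDir v c → SameDir v w
  sameDir⁺ v (z , d) = trans (cross-as-⟪⟫ (vec v) (vec w)) (zero⁺ (perp (vec v)) (trans (sym (cross-as-⟪⟫ (vec v) (vec c))) z)) , pos⁺ (vec v) d

  unstable⁺ : ∀ {𝒰} → Unstable 𝒰 c → Unstable 𝒰 w
  unstable⁺ = Any.map (All.map λ {x} → inH⁺ x)

  unstable⁻ : ∀ {𝒰} → Unstable 𝒰 w → Unstable 𝒰 c
  unstable⁻ = Any.map (All.map λ {x} → inH⁻ x)

  isolated⁺ : ∀ {𝒰} → IsolatedStable 𝒰 c → IsolatedStable 𝒰 w
  isolated⁺ (st , v₁ , v₂ , h₁ , h₂ , near) = (λ un → st (unstable⁻ un)) , v₁ , v₂
    , subst (+ 0 <_) (sym (cross-as-⟪⟫ (vec v₁) (vec w))) (pos⁺ (perp (vec v₁)) (subst (+ 0 <_) (cross-as-⟪⟫ (vec v₁) (vec c)) h₁))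
    , subst (+ 0 <_) (sym (cross-as-⟪⟫′ (vec w) (vec v₂))) (pos⁺ (neg (perp (vec v₂))) (subst (+ 0 <_) (cross-as-⟪⟫′ (vec c) (vec v₂)) h₂))
    , λ v q₁ q₂ notSame → near v q₁ q₂ λ s → notSame (sameDir⁺ v s)

  alpha⁺ : ∀ {𝒰 k} → AlphaLE 𝒰 c k → AlphaLE 𝒰 w k
  alpha⁺ (inj₁ un) = inj₁ (unstable⁺ un)
  alpha⁺ {𝒰} (inj₂ (iso , Z , le , notH , infinite)) = inj₂ (isolated⁺ iso , Z , le , All.map (λ {z} q r → q (inH⁻ z r)) notH ,
    λ (L , cover) → infinite (L , λ x (inC , nH) → cover x
      (closure⊆closed (closure-closed 𝒰 _) (λ y q → 0 , Sum.map₁ (inH⁺ y) q) x inC , λ q → nH (inH⁻ x q))))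

-- The rule that makes `c` unstable, or the one for the side of `c` facing `w`, contains an `x` with
-- `⟪ x , w ⟫ ≥ 0` because `w` is stable, and then `⟪ x , c ⟫ < 0`. The sweep towards `w` thus
-- continues until it reaches the ray of `w`.
stable-candidate : ∀ {𝒰} v w → InSemicircle v w → Stable 𝒰 w →
                   (∀ c → c ∈ candidates (concat 𝒰) → InSemicircle v c → Unstable 𝒰 c ⊎ TwoSided 𝒰 c) →
                   ∃[ c ] (c ∈ candidates (concat 𝒰) × InSemicircle v c × SameDir c w)
stable-candidate {𝒰} v w w∈ stable good = sweep (concat 𝒰) (vec w) (vec v) w∈ λ c c∈ c∈C → step c c∈ c∈C (good c c∈ c∈C)
  where
  Turn : Direction → Set
  Turn c = (∃[ c ] (c ∈ candidates (concat 𝒰) × InSemicircle v c × SameDir c w)) ⊎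
           ∃[ x ] (x ∈ concat 𝒰 × + 0 ≤ ⟪ x , vec w ⟫ × ⟪ x , vec c ⟫ < + 0)
  blocked : ∀ U → U ∈ 𝒰 → ∃[ x ] (x ∈ U × + 0 ≤ ⟪ x , vec w ⟫)
  blocked U U∈ = let x , x∈ , q = find (Allₚ.¬All⇒Any¬ (λ x → ⟪ x , vec w ⟫ ℤₚ.<? + 0) U (λ all → stable (lose U∈ all))) in x , x∈ , ℤₚ.≮⇒≥ q
  turn-at : ∀ c q b → + 0 < b → (∀ x → ⟪ x , vec c ⟫ ≡ + 0 → ⟪ vec c , vec c ⟫ * ⟪ x , vec w ⟫ ≡ b * ⟪ x , q ⟫) → Side 𝒰 (vec c) q → Turn c
  turn-at c q b b>0 eq side =
    let U , U∈ , all = find side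
        x , x∈ , xw = blocked U U∈
    in case {x} {U} (x∈ , U∈) xw (All.lookup all x∈)
    where
    case : ∀ {x U} → x ∈ U × U ∈ 𝒰 → + 0 ≤ ⟪ x , vec w ⟫ → ⟪ x , vec c ⟫ < + 0 ⊎ (⟪ x , vec c ⟫ ≡ + 0 × ⟪ x , q ⟫ < + 0) → Turn c
    case {x} (x∈ , U∈) xw (inj₁ xc) = inj₂ (x , ∈-concat⁺′ x∈ U∈ , xw , xc)
    case {x} _ xw (inj₂ (xc≡0 , xq)) = ⊥-elim (ℤₚ.<⇒≱ (cancel-<0 {⟪ vec c , vec c ⟫} {⟪ x , vec w ⟫} (norm>0 (vec c) (proj₂ c))
      (subst (_< + 0) (sym (eq x xc≡0)) (pos*neg {b} {⟪ x , q ⟫} b>0 xq))) xw)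
  step : ∀ c → c ∈ candidates (concat 𝒰) → InSemicircle v c → Unstable 𝒰 c ⊎ TwoSided 𝒰 c → Turn c
  step c c∈ c∈C (inj₁ un) =
    let U , U∈ , all = find un
        x , x∈ , xw = blocked U U∈
    in inj₂ (x , ∈-concat⁺′ x∈ U∈ , xw , All.lookup all x∈)
  step c c∈ c∈C (inj₂ (left , right)) with ℤₚ.<-cmp (+ 0) ⟪ vec w , perp (vec c) ⟫
  ... | tri< b>0 _ _ = turn-at c (perp (vec c)) ⟪ vec w , perp (vec c) ⟫ b>0
          (λ x e → trans (decompose (vec c) x (vec w)) (trans (cong (λ s → ⟪ vec w , vec c ⟫ * s + ⟪ vec w , perp (vec c) ⟫ * ⟪ x , perp (vec c) ⟫) e)
             (lem ⟪ vec w , vec c ⟫ ⟪ vec w , perp (vec c) ⟫ ⟪ x , perp (vec c) ⟫))) left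
    where
    lem : ∀ a b r → a * + 0 + b * r ≡ b * r
    lem = solve-∀
  ... | tri> _ _ b<0 = turn-at c (neg (perp (vec c))) (- ⟪ vec w , perp (vec c) ⟫) (<0⇒->0 b<0)
          (λ x e → trans (decompose (vec c) x (vec w)) (trans (cong (λ s → ⟪ vec w , vec c ⟫ * s + ⟪ vec w , perp (vec c) ⟫ * ⟪ x , perp (vec c) ⟫) e)
             (trans (lem ⟪ vec w , vec c ⟫ ⟪ vec w , perp (vec c) ⟫ ⟪ x , perp (vec c) ⟫) (cong (- ⟪ vec w , perp (vec c) ⟫ *_) (sym (⟪⟫-negʳ x (perp (vec c)))))))) right
    where
    lem : ∀ a b r → a * + 0 + b * r ≡ - b * - r
    lem = solve-∀
  -- Parallel, and not opposite because both lie in the semicircle of `v`.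
  ... | tri≈ _ b≡0 _ = inj₁ (c , c∈ , c∈C , trans (cross-⟪⟫ (vec c) (vec w)) (sym b≡0) ,
          cancel->0 c∈C (subst (+ 0 <_) eq (>0*>0 (norm>0 (vec c) (proj₂ c)) (subst (+ 0 <_) (⟪⟫-comm (vec w) (vec v)) w∈))))
    where
    eq : ⟪ vec c , vec c ⟫ * ⟪ vec v , vec w ⟫ ≡ ⟪ vec c , vec v ⟫ * ⟪ vec c , vec w ⟫
    eq = trans (decompose (vec c) (vec v) (vec w)) (trans (cong (λ b → ⟪ vec w , vec c ⟫ * ⟪ vec v , vec c ⟫ + b * ⟪ vec v , perp (vec c) ⟫) (sym b≡0))
      (trans (ℤₚ.+-identityʳ (⟪ vec w , vec c ⟫ * ⟪ vec v , vec c ⟫)) (trans (ℤₚ.*-comm ⟪ vec w , vec c ⟫ ⟪ vec v , vec c ⟫) (cong₂ _*_ (⟪⟫-comm (vec v) (vec c)) (⟪⟫-comm (vec w) (vec c))))))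

-- Growth along the boundary line

module LineGrowth (𝒰 : UpdateFamily) (u : Direction) (side : Side 𝒰 (vec u) (perp (vec u))) where

  open Strip 𝒰 u 0 0

  W-notH : All (λ z → ¬ InH u z) W
  W-notH = All.tabulate λ z∈ → ℤₚ.≤⇒≯ (proj₁ (proj₁ (∈-W⁻ z∈)))

  Grown : Point → Set
  Grown = Closure 𝒰 (λ z → InH u z ⊎ z ∈ W)

  -- The rule from `side` uses the half-plane and points of the line further back by at most `ρ`.
  -- The segment `W` is long enough to supply them, so the infection advances step by step.
  grown : ∀ n z → y z ≡ + 0 → + 0 ≤ t z → t z < T + + n → Grown z
  grown n z yz tz≥0 tz< with t z ℤₚ.<? T
  ... | yes lt = 0 , inj₂ (∈-W⁺ ((ℤₚ.≤-reflexive (sym yz) , ℤₚ.≤-reflexive yz) , tz≥0 , lt))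
  grown zero z yz tz≥0 tz< | no ge = ⊥-elim (ge (subst (t z <_) (ℤₚ.+-identityʳ T) tz<))
  grown (suc n) z yz tz≥0 tz< | no ge = closure-closed 𝒰 _ z
    (let U , U∈ , all = find side in lose U∈ (All.tabulate λ {o} o∈ → next o (∈-concat⁺′ o∈ U∈) (All.lookup all o∈)))
    where
    y-⊕ : ∀ o → y (z ⊕ o) ≡ y o
    y-⊕ o = trans (⟪⟫-⊕ˡ z o (vec u)) (trans (cong (_+ y o) yz) (ℤₚ.+-identityˡ (y o)))
    next : ∀ o → o ∈ concat 𝒰 → y o < + 0 ⊎ (y o ≡ + 0 × t o < + 0) → Grown (z ⊕ o)
    next o o∈ (inj₁ yo<0) = 0 , inj₁ (subst (_< + 0) (sym (y-⊕ o)) yo<0)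
    next o o∈ (inj₂ (yo≡0 , to<0)) = grown n (z ⊕ o) (trans (y-⊕ o) yo≡0)
      (subst (+ 0 ≤_) (sym (⟪⟫-⊕ˡ z o p)) (≤-by
        (≥0+≥0 (≥0+≥0 (diff≥0 (ℤₚ.≮⇒≥ ge)) (diff≥0 (proj₁ (abs-bounds (t o) (≤absBound t o∈))))) (≥0+≥0 (+≤+ {0} {ρ} ℕ.z≤n) (ℤₚ.<⇒≤ N>0)))
        (lem₁ (t z) (t o) (+ ρ) N)))
      (subst (_< T + + n) (sym (⟪⟫-⊕ˡ z o p)) (<-by (>0+≥0 (diff>0 tz<) (diff≥0 (ℤₚ.i<j⇒suc[i]≤j to<0))) (lem₂ (t z) (t o) T (+ n))))
      where
      lem₁ : ∀ t o r n → t + o - + 0 ≡ ((t - (r + r + n)) + (o - - r)) + (r + n)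
      lem₁ = solve-∀
      lem₂ : ∀ t o T n → T + n - (t + o) ≡ (T + (+ 1 + n) - t) + (+ 0 - (+ 1 + o))
      lem₂ = solve-∀

  W-infinite : InfiniteSet (ZBar 𝒰 u W)
  W-infinite (L , cover) = ℤₚ.<⇒≱ (ℤₚ.<-≤-trans (+<+ {b} {suc b} ℕₚ.≤-refl) tz≥)
      (proj₂ (abs-bounds (t z) (≤absBound t (cover z (grown ∣ t z ∣ z yz tz≥0 tz< , λ q → ℤₚ.<-irrefl yz q)))))
    where
    b : ℕ
    b = absBound t L
    z : Point
    z = shift (+ suc b) origin
    yz : y z ≡ + 0
    yz = trans (y-shift (+ suc b) origin) (⟪origin⟫ (vec u))
    tz : t z ≡ + suc b * N
    tz = trans (t-shift (+ suc b) origin) (trans (cong (_+ + suc b * N) (⟪origin⟫ p)) (ℤₚ.+-identityˡ (+ suc b * N)))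
    tz≥ : + suc b ≤ t z
    tz≥ = subst (+ suc b ≤_) (sym tz) (i≤i*N (+ suc b) (+≤+ ℕ.z≤n))
    tz≥0 : + 0 ≤ t z
    tz≥0 = ℤₚ.≤-trans (+≤+ ℕ.z≤n) tz≥
    tz< : t z < T + + ∣ t z ∣
    tz< = <-by (>0+≥0 T>0 (diff≥0 (proj₂ (abs-bounds (t z) ℕₚ.≤-refl)))) (lem T (+ ∣ t z ∣) (t z))
      where
      lem : ∀ T a t → T + a - t ≡ T + (a - t)
      lem = solve-∀

-- Bounded search and the decision procedure

module Search {P : ℕ → Set} (P? : ∀ k → Dec (P k)) where

  search : ℕ → ℕ → Maybe ℕ
  search fuel k with P? k
  search fuel k | yes _ = just k
  search zero k | no _ = nothing
  search (suc fuel) k | no _ = search fuel (suc k)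

  search-least : ∀ fuel k → (∀ j → j ℕ.< k → ¬ P j) → P (k ℕ.+ fuel) →
                 ∃[ m ] (search fuel k ≡ just m × P m × (∀ j → j ℕ.< m → ¬ P j))
  search-least fuel k below top with P? k
  search-least fuel k below top | yes p = k , refl , p , below
  search-least zero k below top | no ¬p = ⊥-elim (¬p (subst P (ℕₚ.+-identityʳ k) top))
  search-least (suc fuel) k below top | no ¬p = search-least fuel (suc k) below′ (subst P (ℕₚ.+-suc k fuel) top)
    where
    below′ : ∀ j → j ℕ.< suc k → ¬ P j
    below′ j (ℕ.s≤s j≤k) with ℕₚ.m≤n⇒m<n∨m≡n j≤k
    ... | inj₁ j<k = below j j<k
    ... | inj₂ refl = ¬p

  search-correct : ∀ {D : Maybe ℕ → Set} → (∀ m → P m → (∀ j → j ℕ.< m → ¬ P j) → D (just m)) → ∀ n → P n → D (search n 0)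
  search-correct {D} least n top =
    let m , eq , p , below = search-least n 0 (λ _ ()) top in subst D (sym eq) (least m p below)

module Decision (𝒰 : UpdateFamily) where

  -- The semicircles are given by their centres. Signs are reversed since `sweep` turns at `x` with
  -- `⟪ x , v ⟫ ≥ 0` and `⟪ x , c ⟫ < 0`, whereas a direction to be expelled has the opposite signs.
  directions stables semicircles : List Direction
  directions = candidates (concat 𝒰)
  stables = filter (λ c → ¬? (unstable? 𝒰 c)) directions
  semicircles = candidates (map (neg ∘ vec) directions)

  ∈-stables : ∀ c → c ∈ directions → Stable 𝒰 c → c ∈ stables
  ∈-stables c c∈ st = ∈-filter⁺ (λ c → ¬? (unstable? 𝒰 c)) {x = c} {xs = directions} c∈ st

  height : Direction → ℕ → ℕ
  height u k = HeightReduction.height 𝒰 stables u k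

  -- The decidable counterpart of `AlphaLE` for critical families.
  Good : ℕ → Direction → Set
  Good k u = Unstable 𝒰 u ⊎ (TwoSided 𝒰 u × Strip.Rejected 𝒰 u (height u k) k k)

  good? : ∀ k u → Dec (Good k u)
  good? k u = unstable? 𝒰 u ⊎-dec (twoSided? 𝒰 u ×-dec Strip.Rejected? 𝒰 u (height u k) k k)

  GoodSemicircle : ℕ → Direction → Set
  GoodSemicircle k v = All (λ c → InSemicircle v c → Good k c) directions

  goodSemicircle? : ∀ k v → Dec (GoodSemicircle k v)
  goodSemicircle? k v = All.all? (λ c → (+ 0 ℤₚ.<? ⟪ vec c , vec v ⟫) →-dec good? k c) directions

  Easy : ℕ → Set
  Easy k = Any (GoodSemicircle k) semicircles

  easy? : ∀ k → Dec (Easy k)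
  easy? k = any? (goodSemicircle? k) semicircles

  -- The sum is a common upper bound for the sizes of the segments used in `LineGrowth`.
  bound : ℕ
  bound = sum (map (λ c → length (Strip.W 𝒰 c 0 0)) directions)

  difficulty : Maybe ℕ
  difficulty = Search.search easy? bound 0

  alpha⇒sides : ∀ {k} c → AlphaLE 𝒰 c k → Unstable 𝒰 c ⊎ TwoSided 𝒰 c
  alpha⇒sides c = Sum.map₂ λ (iso , _) → isolated⇒twoSided c iso

  extend : ∀ {k} v → (∀ c → c ∈ directions → InSemicircle v c → AlphaLE 𝒰 c k) → ∀ u → InSemicircle v u → AlphaLE 𝒰 u k
  extend v good u u∈ with unstable? 𝒰 u
  ... | yes un = inj₁ un
  ... | no st = let c , c∈ , c∈C , same = stable-candidate {𝒰} v u u∈ st (λ c c∈ c∈C → alpha⇒sides c (good c c∈ c∈C))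
                in Proportional.alpha⁺ c u same {𝒰} (good c c∈ c∈C)

  all-unstable⇒supercritical : ∀ v → (∀ c → c ∈ directions → InSemicircle v c → Unstable 𝒰 c) → Supercritical 𝒰
  all-unstable⇒supercritical v unst = v , λ u u∈ → decidable-stable (unstable? 𝒰 u) λ st →
    let c , c∈ , c∈C , same = stable-candidate {𝒰} v u u∈ st (λ c c∈ c∈C → inj₁ (unst c c∈ c∈C))
    in st (Proportional.unstable⁺ c u same {𝒰} (unst c c∈ c∈C))

  module _ (critical : Critical 𝒰) where

    stables-stable : All (Stable 𝒰) stables
    stables-stable = All.tabulate λ s∈ → proj₂ (∈-filter⁻ (λ c → ¬? (unstable? 𝒰 c)) {xs = directions} s∈)

    -- A semicircle without stable candidates has no stable direction at all, which would make the
    -- family supercritical.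
    meets : ∀ v → v ≢ origin → ∃[ s ] (s ∈ stables × + 0 < ⟪ vec s , v ⟫)
    meets v v≢0 with any? (λ s → + 0 ℤₚ.<? ⟪ vec s , v ⟫) stables
    ... | yes some = find some
    ... | no none = ⊥-elim (proj₁ critical (all-unstable⇒supercritical (v , v≢0) λ c c∈ c∈C →
          decidable-stable (unstable? 𝒰 c) λ st → none (lose (∈-stables c c∈ st) c∈C)))

    good⇒alpha : ∀ {k} u → Good k u → AlphaLE 𝒰 u k
    good⇒alpha u (inj₁ un) = inj₁ un
    good⇒alpha {k} u (inj₂ (sides , rej)) = decide (unstable? 𝒰 u)
      where
      decide : Dec (Unstable 𝒰 u) → AlphaLE 𝒰 u k
      decide (yes un) = inj₁ un
      decide (no st) = inj₂ (twoSided⇒isolated u st sides , StripWords.rejected⇒infinite 𝒰 u (height u k) k rej)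

    alpha⇒good : ∀ {k} u → AlphaLE 𝒰 u k → Good k u
    alpha⇒good u (inj₁ un) = inj₁ un
    alpha⇒good {k} u (inj₂ (iso , Z , le , notH , infinite)) = inj₂ (isolated⇒twoSided u iso ,
      decidable-stable (Strip.Rejected? 𝒰 u (height u k) k k) λ none →
        infinite (closable⇒finite {𝒰} {u} {Z} (HeightReduction.all-closable 𝒰 stables u k stables-stable meets (proj₁ iso)
          (StripWords.strip-closable 𝒰 u (height u k) k (proj₁ iso) none) Z le notH)))

    easy⇒difficultyLE : ∀ {k} → Easy k → DifficultyLE 𝒰 k
    easy⇒difficultyLE easy = let v , _ , good = find easy in
      v , extend v λ c c∈ c∈C → good⇒alpha c (All.lookup good c∈ c∈C)

    -- A candidate centre is rotated towards `v`. A bad direction `d` in its semicircle lies outside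
    -- that of `v`, so the centre can be turned until `d` is on the boundary.
    difficultyLE⇒easy : ∀ {k} → DifficultyLE 𝒰 k → Easy k
    difficultyLE⇒easy {k} (v , alpha) = sweep (map (neg ∘ vec) directions) (vec v) (vec v) (norm>0 (vec v) (proj₂ v))
        λ c c∈ c∈C → step c c∈ (goodSemicircle? k c)
      where
      step : ∀ c → c ∈ semicircles → Dec (GoodSemicircle k c) →
             Easy k ⊎ ∃[ x ] (x ∈ map (neg ∘ vec) directions × + 0 ≤ ⟪ x , vec v ⟫ × ⟪ x , vec c ⟫ < + 0)
      step c c∈ (yes good) = inj₁ (lose c∈ good)
      step c c∈ (no bad) =
        let d , d∈ , fails = find (Allₚ.¬All⇒Any¬ (λ d → (+ 0 ℤₚ.<? ⟪ vec d , vec c ⟫) →-dec good? k d) directions bad)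
            d∈C = decidable-stable (+ 0 ℤₚ.<? ⟪ vec d , vec c ⟫) λ n → fails λ q → ⊥-elim (n q)
            d∉V = λ q → fails λ _ → alpha⇒good d (alpha d q)
        in inj₂ (neg (vec d) , ∈-map⁺ (neg ∘ vec) d∈
                , subst (+ 0 ≤_) (sym (⟪⟫-negˡ (vec d) (vec v))) (≤0⇒-≥0 (ℤₚ.≮⇒≥ d∉V))
                , subst (_< + 0) (sym (⟪⟫-negˡ (vec d) (vec c))) (>0⇒-<0 d∈C))

    -- In a semicircle with finitely many stable directions each stable candidate is two-sided, so
    -- its segment grows forever and the search succeeds.
    easy-bound : Easy bound
    easy-bound = let v , L , fin = proj₂ critical in difficultyLE⇒easy (v , extend v λ c c∈ c∈C →
        decide v L fin c c∈ c∈C (unstable? 𝒰 c))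
      where
      decide : ∀ v L → (∀ u → InSemicircle v u → Stable 𝒰 u → Any (λ w → SameDir u w) L) →
               ∀ c → c ∈ directions → InSemicircle v c → Dec (Unstable 𝒰 c) → AlphaLE 𝒰 c bound
      decide v L fin c c∈ c∈C (yes un) = inj₁ un
      decide v L fin c c∈ c∈C (no st) =
        let sides = finitely-stable⇒twoSided v L fin c c∈C
        in inj₂ (twoSided⇒isolated c st sides , Strip.W 𝒰 c 0 0 , ∈⇒≤sum (λ c → length (Strip.W 𝒰 c 0 0)) c∈ ,
                 LineGrowth.W-notH 𝒰 c (proj₁ sides) , LineGrowth.W-infinite 𝒰 c (proj₁ sides))

    difficulty-correct : IsDifficulty 𝒰 difficulty
    difficulty-correct = Search.search-correct easy? {IsDifficulty 𝒰}
      (λ m easy least → easy⇒difficultyLE easy , λ j j<m d → least j j<m (difficultyLE⇒easy d)) bound easy-bound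

theorem1p1 : Σ (UpdateFamily → Maybe ℕ)
    (λ alg → ∀ 𝒰 → ValidFamily 𝒰 → Critical 𝒰 → IsDifficulty 𝒰 (alg 𝒰))
theorem1p1 = Decision.difficulty , λ 𝒰 _ critical → Decision.difficulty-correct 𝒰 critical
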